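{- The language $L_\mathrm{ENT} \cap L_\mathrm{PRE}$ is decidable in pseudo-polynomial time, where $L_\mathrm{ENT} = \{\langle\Sigma, A \Rightarrow B\rangle \mid \Sigma \text{ is a finite theory and } \Sigma \vdash A \Rightarrow B\}$ and $L_\mathrm{PRE} = \{\langle\Sigma, A \Rightarrow B\rangle \mid \Sigma \text{ is finite and } \Sigma \text{ and } A \Rightarrow B \text{ are predictive}\}$.
   Context: $Y$ is a fixed non-empty finite set of attributes and $\mathcal{T}_Y = \{y^i \mid y \in Y, i \in \mathbb{Z}\}$; $M + j = \{y^{i+j} \mid y^i \in M\}$. A formula is $A \Rightarrow B$ with $A,B$ finite subsets of $\mathcal{T}_Y$; a theory is a set of formulas; $\langle\Sigma, A \Rightarrow B\rangle$ is a standard encoding (time points as integers). A formula $A \Rightarrow B$ is predictive if $A \neq \emptyset$, $B \neq \emptyset$ and $i \leq j$ for all $x^i \in A$, $y^j \in B$; a theory is predictive if all its formulas are. Deduction rules (for finite $A,B,C,D \subseteq \mathcal{T}_Y$, $i \in \mathbb{Z}$): (Ax) infer $A \cup B \Rightarrow A$; (Cut) from $A \Rightarrow B$ and $B \cup C \Rightarrow D$ infer $A \cup C \Rightarrow D$; (Shf) from $A \Rightarrow B$ infer $A+i \Rightarrow B+i$; $\Sigma \vdash A \Rightarrow B$ means there is a finite sequence ending with $A \Rightarrow B$ each member of which is in $\Sigma$ or follows from earlier members by these rules. Pseudo-polynomial time means running time bounded by a polynomial in the size of the input and the magnitude of the numeric values (integers) occurring in it. -}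

module Defs where

open import Data.Bool.Base using (Bool; true; false; if_then_else_)
open import Data.Fin.Base using (Fin; toℕ) renaming (zero to 0F; suc to sucF)
open import Data.Integer.Base as ℤ using (ℤ; ∣_∣)
open import Data.List.Base using (List; []; _∷_; _++_; map; foldr; concatMap)
open import Data.List.Extrema.Nat using (max)
open import Data.List.Membership.Propositional using (_∈_)
open import Data.List.Relation.Binary.BagAndSetEquality using (_∼[_]_; set)
open import Data.List.Relation.Unary.All using (All)
open import Data.List.Relation.Unary.Any using (Any)
open import Data.Nat.Base using (ℕ; suc; _+_; _≤_)
open import Data.Nat.Binary.Base using (ℕᵇ; 2[1+_]; 1+[2_]; fromℕ)
  renaming (zero to 0ᵇ)
open import Data.Nat.Solver using (module +-*-Solver)
open import Data.Product.Base using (Σ; ∃-syntax; _×_; _,_; proj₂)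
open import Data.Sign.Base as Sign using (Sign)
open import Data.Sum.Base using (_⊎_)
open import Data.Vec.Base using (Vec; []; _∷_; lookup; _[_]≔_; replicate)
open import Function.Base using (_∘_)
open import Level using (0ℓ)
open import Relation.Binary.PropositionalEquality using (_≡_; _≢_)
open import Relation.Nullary using (¬_)
open import Relation.Unary using (Pred)

open +-*-Solver using (Polynomial; ⟦_⟧)

private
  variable
    n k : ℕ

------------------------------------------------------------------------
-- Formulas over the attributes Y = Fin n

-- (y , i) is the attribute y at time point i.
TimedAttribute : ℕ → Set
TimedAttribute n = Fin n × ℤ

-- Finite subsets of TimedAttribute n are represented by lists; two lists
-- denote the same subset iff they are related by _∼[ set ]_.
FiniteSubset : ℕ → Set
FiniteSubset n = List (TimedAttribute n)

infix 6 _⊕_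
_⊕_ : FiniteSubset n → ℤ → FiniteSubset n
M ⊕ j = map (λ (y , i) → y , i ℤ.+ j) M

infix 4.5 _⇒_
record Formula (n : ℕ) : Set where
  constructor _⇒_
  field
    antecedent : FiniteSubset n
    consequent : FiniteSubset n

open Formula public

infix 4 _≈_ _∈ᶠ_ _⊢_
_≈_ : Formula n → Formula n → Set
φ ≈ ψ = (antecedent φ ∼[ set ] antecedent ψ) ×
        (consequent φ ∼[ set ] consequent ψ)

FiniteTheory : ℕ → Set
FiniteTheory n = List (Formula n)

_∈ᶠ_ : Formula n → List (Formula n) → Set
φ ∈ᶠ T = Any (φ ≈_) T

Predictive : Formula n → Set
Predictive (A ⇒ B) =
  A ≢ [] × B ≢ [] × (∀ {x i y j} → (x , i) ∈ A → (y , j) ∈ B → i ℤ.≤ j)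

------------------------------------------------------------------------
-- Provability

data FollowsFrom {n} (Γ : List (Formula n)) : Formula n → Set where
  ax  : ∀ A B → FollowsFrom Γ (A ++ B ⇒ A)
  cut : ∀ A B C D → (A ⇒ B) ∈ᶠ Γ → (B ++ C ⇒ D) ∈ᶠ Γ →
        FollowsFrom Γ (A ++ C ⇒ D)
  shf : ∀ A B i → (A ⇒ B) ∈ᶠ Γ → FollowsFrom Γ (A ⊕ i ⇒ B ⊕ i)

-- Deduction sequences, the most recent formula first.
data IsDeduction {n} (T : FiniteTheory n) : List (Formula n) → Set where
  []     : IsDeduction T []
  hyp    : ∀ {φ Γ} → φ ∈ᶠ T → IsDeduction T Γ → IsDeduction T (φ ∷ Γ)
  follow : ∀ {φ ψ Γ} → φ ≈ ψ → FollowsFrom Γ ψ → IsDeduction T Γ →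
           IsDeduction T (φ ∷ Γ)

_⊢_ : FiniteTheory n → Formula n → Set
T ⊢ φ = ∃[ Γ ] IsDeduction T (φ ∷ Γ)

------------------------------------------------------------------------
-- The machine model: Jones's WHILE language (N. D. Jones, Computability
-- and Complexity from a Programming Perspective).  Data are binary
-- trees, and a program is a command over finitely many tree-valued
-- variables.  Assignment copies a pointer and nil is the only value that
-- can be tested, so each operation has unit cost; this time measure
-- agrees with that of Turing machines up to a polynomial.

data Tree : Set where
  nil  : Tree
  cons : Tree → Tree → Tree

size : Tree → ℕ
size nil        = 1
size (cons s t) = suc (size s + size t)

data Expr (k : ℕ) : Set where
  var   : Fin k → Expr k
  nil   : Expr k
  cons  : Expr k → Expr k → Expr k
  hd tl : Expr k → Expr k

infix  5 _:=_
infixr 4 _⨾_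
data Command (k : ℕ) : Set where
  _:=_  : Fin k → Expr k → Command k
  _⨾_   : Command k → Command k → Command k
  cond  : Expr k → Command k → Command k → Command k
  while : Expr k → Command k → Command k

Store : ℕ → Set
Store k = Vec Tree k

head tail : Tree → Tree
head nil        = nil
head (cons s t) = s
tail nil        = nil
tail (cons s t) = t

eval : Expr k → Store k → Tree
eval (var x)    σ = lookup σ x
eval nil        σ = nil
eval (cons e f) σ = cons (eval e σ) (eval f σ)
eval (hd e)     σ = head (eval e σ)
eval (tl e)     σ = tail (eval e σ)

cost : Expr k → ℕ
cost (var x)    = 1
cost nil        = 1
cost (cons e f) = suc (cost e + cost f)
cost (hd e)     = suc (cost e)
cost (tl e)     = suc (cost e)

Truthy : Tree → Set
Truthy t = t ≢ nil

-- ⟨ c , σ ⟩⇓ τ in-time t : started in the store σ, the command c halts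
-- with the store τ after t units of time.
infix 3 ⟨_,_⟩⇓_in-time_
data ⟨_,_⟩⇓_in-time_ {k} :
       Command k → Store k → Store k → ℕ → Set where
  assign : ∀ {x e σ} →
    ⟨ x := e , σ ⟩⇓ σ [ x ]≔ eval e σ in-time suc (cost e)
  seq : ∀ {c d ρ σ τ s t} →
    ⟨ c , ρ ⟩⇓ σ in-time s → ⟨ d , σ ⟩⇓ τ in-time t →
    ⟨ c ⨾ d , ρ ⟩⇓ τ in-time s + t
  cond-true : ∀ {e c d σ τ t} → Truthy (eval e σ) →
    ⟨ c , σ ⟩⇓ τ in-time t →
    ⟨ cond e c d , σ ⟩⇓ τ in-time suc (cost e + t)
  cond-false : ∀ {e c d σ τ t} → eval e σ ≡ nil →
    ⟨ d , σ ⟩⇓ τ in-time t →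
    ⟨ cond e c d , σ ⟩⇓ τ in-time suc (cost e + t)
  while-true : ∀ {e c ρ σ τ s t} → Truthy (eval e ρ) →
    ⟨ c , ρ ⟩⇓ σ in-time s → ⟨ while e c , σ ⟩⇓ τ in-time t →
    ⟨ while e c , ρ ⟩⇓ τ in-time suc (cost e + s + t)
  while-false : ∀ {e c σ} → eval e σ ≡ nil →
    ⟨ while e c , σ ⟩⇓ σ in-time suc (cost e)

-- Variable 0 holds the input and the output; the k work variables are
-- initially nil.
Program : Set
Program = ∃[ k ] Command (suc k)

RunsTo : Program → Tree → Tree → ℕ → Set
RunsTo (k , c) input output t =
  ∃[ τ ] ⟨ c , input ∷ replicate k nil ⟩⇓ output ∷ τ in-time t

------------------------------------------------------------------------
-- Pseudo-polynomial time

Language : Set₁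
Language = Pred Tree 0ℓ

-- A decider has to halt on every tree.  On the encoding of an instance
-- the least admissible m is the magnitude of that instance; on a tree
-- that encodes no instance it is 0.  Polynomials have coefficients in ℕ
-- (for these the solver interprets its formal negation as the identity).
DecidableInPseudoPolynomialTime :
  {Instance : Set} → (Instance → Tree) → (Instance → ℕ) → Language → Set
DecidableInPseudoPolynomialTime encode magnitude L =
  Σ Program λ p → Σ (Polynomial 2) λ q →
  ∀ (d : Tree) → ∃[ output ] ∃[ t ]
    RunsTo p d output t ×
    (∀ m → (∀ I → encode I ≡ d → magnitude I ≤ m) →
       t ≤ ⟦ q ⟧ (size d ∷ m ∷ [])) ×
    ((Truthy output × L d) ⊎ (output ≡ nil × ¬ L d))

------------------------------------------------------------------------
-- Instances and their encoding

Instance : ℕ → Set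
Instance n = FiniteTheory n × Formula n

encodeBool : Bool → Tree
encodeBool b = if b then cons nil nil else nil

encodeList : {A : Set} → (A → Tree) → List A → Tree
encodeList f = foldr (cons ∘ f) nil

-- The attributes are finitely many fixed symbols, so it is immaterial
-- that this numeral is unary.
encodeAttribute : Fin n → Tree
encodeAttribute 0F       = nil
encodeAttribute (sucF y) = cons nil (encodeAttribute y)

-- The list of bijective base-2 digits, least significant digit first.
encodeℕᵇ : ℕᵇ → Tree
encodeℕᵇ 0ᵇ       = nil
encodeℕᵇ 2[1+ b ] = cons (encodeBool true) (encodeℕᵇ b)
encodeℕᵇ 1+[2 b ] = cons (encodeBool false) (encodeℕᵇ b)

encodeSign : Sign → Tree
encodeSign Sign.+ = encodeBool false
encodeSign Sign.- = encodeBool true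

encodeℤ : ℤ → Tree
encodeℤ i = cons (encodeSign (ℤ.sign i)) (encodeℕᵇ (fromℕ ∣ i ∣))

encodeTimedAttribute : TimedAttribute n → Tree
encodeTimedAttribute (y , i) = cons (encodeAttribute y) (encodeℤ i)

encodeFormula : Formula n → Tree
encodeFormula (A ⇒ B) =
  cons (encodeList encodeTimedAttribute A) (encodeList encodeTimedAttribute B)

encodeInstance : Instance n → Tree
encodeInstance (T , φ) = cons (encodeList encodeFormula T) (encodeFormula φ)

timePoints : Formula n → List ℤ
timePoints (A ⇒ B) = map proj₂ (A ++ B)

magnitudeInstance : Instance n → ℕ
magnitudeInstance (T , φ) = max 0 (map ∣_∣ (concatMap timePoints (φ ∷ T)))

L-ENT : ℕ → Language
L-ENT n d = Σ (Instance n) λ (T , φ) → encodeInstance (T , φ) ≡ d × T ⊢ φ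

L-PRE : ℕ → Language
L-PRE n d = Σ (Instance n) λ (T , φ) →
  encodeInstance (T , φ) ≡ d × All Predictive T × Predictive φ

{-# OPTIONS --safe #-}

-- Provability of A ⇒ B amounts to B being included in the closure of A
-- under all shifts of the rules.  If K bounds the absolute values of the
-- time points and the formulas are predictive, then a time point at most
-- K of the closure is derived from time points between −K and K only,
-- with shifts between −2K and 2K.  The times are therefore written in
-- unary with offsets making them natural numbers, and every rule is
-- applied with each of these 4K + 1 shifts, in as many rounds as there
-- are attributes at the 4K + 1 times: a round adding no such cell leaves
-- nothing to be derived.  Facts are never compared with the known ones
-- before they are added, so that a round lengthens the list of facts by
-- an amount independent of that list.
--
-- All of this takes polynomial time once the powers of 2 up to the length
-- of the longest numeral are available in unary.  Their size is linear in
-- the magnitude of the instance, and they are computed only for trees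
-- that have been recognised as encodings.
module Submission where

open import Data.Bool.Base using (Bool; true; false)
open import Data.Fin.Base using (Fin; toℕ) renaming (zero to 0F; suc to sucF)
open import Data.Fin.Properties using (toℕ-injective; toℕ<n)
open import Data.Integer.Base as ℤ using (ℤ; 0ℤ; -[1+_]; ∣_∣; +≤+; -≤+) renaming (+_ to pos)
import Data.Integer.Properties as ℤ
open import Data.Integer.Tactic.RingSolver using (solve-∀)
open import Data.List.Base using (List; []; _∷_; _++_; map; concatMap; length; upTo; cartesianProduct)
open import Data.List.Extrema.Nat using (xs≤max)
open import Data.List.Membership.Propositional using (_∈_; find; lose)
open import Data.List.Membership.Propositional.Properties
  using (∈-map⁺; ∈-map⁻; ∈-++⁺ˡ; ∈-++⁺ʳ; ∈-++⁻; ∈-concatMap⁺; ∈-upTo⁺; ∈-cartesianProduct⁺)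
open import Data.List.Properties using (++-identityʳ; length-upTo; length-++; length-map)
open import Data.List.Relation.Binary.BagAndSetEquality using (set; [_]-Equality)
open import Data.List.Relation.Binary.Subset.Propositional using (_⊆_)
open import Data.List.Relation.Unary.All as All using (All)
open import Data.List.Relation.Unary.Any as Any using (here; there)
open import Data.List.Relation.Unary.Any.Properties using (++⁺ˡ; ++⁺ʳ)
open import Data.Nat.Base using (ℕ; zero; suc; _+_; _*_; _∸_; _^_; _≤_; _<_; z≤n; s≤s; s≤s⁻¹; NonZero)
open import Data.Nat.Binary.Base as Bin using (ℕᵇ; 2[1+_]; 1+[2_]; fromℕ) renaming (zero to 0ᵇ)
open import Data.Nat.Binary.Properties using (toℕ-fromℕ; fromℕ-toℕ)
open import Data.Nat.Properties
open import Data.Nat.Solver using (module +-*-Solver)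
import Data.Nat.Tactic.RingSolver as ℕSolver
open import Data.Product.Base using (∃-syntax; _×_; _,_; proj₁; proj₂)
open import Data.Product.Properties using (≡-dec)
open import Data.Sign.Base as Sign using (Sign)
open import Data.Sum.Base using (_⊎_; inj₁; inj₂; [_,_]′)
open import Data.Vec.Base using ([]; _∷_)
open import Function.Base using (_∘_; id)
open import Function.Bundles using (Equivalence; mk⇔)
open import Relation.Binary.Bundles using (Setoid)
open import Relation.Binary.PropositionalEquality
  using (_≡_; _≢_; refl; sym; trans; cong; cong₂; subst; subst₂; module ≡-Reasoning)
open import Relation.Nullary using (¬_; contradiction; yes; no)
open import Relation.Unary using (_∩_)
open import Defs

open import Data.List.Membership.DecPropositional (≡-dec _≟_ _≟_) using (_∈?_)
open +-*-Solver using (Polynomial; ⟦_⟧; _:+_; _:*_)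

-- Polynomial bounds in one variable

-- The offsets keep all numbers natural. A point `i` of a rule is stored as `i + K` and a shift `j`
-- between -2K and 2K as `k = j + 2K`; the sum of the two is `i + j + 3K`, which forces the offset
-- 3K of the facts, and points up to K then have codes at most 4K. Nothing earlier than -K is ever
-- derived, since a predictive rule has a premise and concludes nothing before it. Facts with codes
-- beyond 4K do arise; they are sound, and the stabilisation argument ignores them. `K` is not the
-- largest absolute value but `2 ^ (l + 1)`, where `l` is the length of the longest numeral: it is
-- obtained by doubling alone, it bounds every value with `l` bijective digits, and it stays linear
-- in the magnitude because such a value is at least `2 ^ l - 1`. On the machine side, each function
-- is kept together with a program, a time bound and a bound on the size of its output. Nested loops
-- remain polynomial because of a restriction on their bodies that is itself preserved by nesting;
-- the doubling loop violates it and gets an invariant of its own.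

infixl 6 _⊞_
infixl 7 _⊠_
infixr 8 _⊚_
-- Composition is a constructor because `g ∘ f` costs what `g` costs at the output size of `f`.
-- Without subtraction every bound is monotone, so that an estimate may replace its argument.
data Bound : Set where
  con         : ℕ → Bound
  arg         : Bound
  _⊞_ _⊠_ _⊚_ : Bound → Bound → Bound

⟪_⟫ : Bound → ℕ → ℕ
⟪ con c ⟫ n = c
⟪ arg ⟫   n = n
⟪ p ⊞ q ⟫ n = ⟪ p ⟫ n + ⟪ q ⟫ n
⟪ p ⊠ q ⟫ n = ⟪ p ⟫ n * ⟪ q ⟫ n
⟪ p ⊚ q ⟫ n = ⟪ p ⟫ (⟪ q ⟫ n)

⟪⟫-mono : ∀ p {m n} → m ≤ n → ⟪ p ⟫ m ≤ ⟪ p ⟫ n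
⟪⟫-mono (con c) m≤n = ≤-refl
⟪⟫-mono arg     m≤n = m≤n
⟪⟫-mono (p ⊞ q) m≤n = +-mono-≤ (⟪⟫-mono p m≤n) (⟪⟫-mono q m≤n)
⟪⟫-mono (p ⊠ q) m≤n = *-mono-≤ (⟪⟫-mono p m≤n) (⟪⟫-mono q m≤n)
⟪⟫-mono (p ⊚ q) m≤n = ⟪⟫-mono p (⟪⟫-mono q m≤n)

substitute : Bound → Polynomial 2 → Polynomial 2
substitute (con c) r = +-*-Solver.con c
substitute arg     r = r
substitute (p ⊞ q) r = substitute p r :+ substitute q r
substitute (p ⊠ q) r = substitute p r :* substitute q r
substitute (p ⊚ q) r = substitute p (substitute q r)

⟦substitute⟧ : ∀ p r ρ → ⟦ substitute p r ⟧ ρ ≡ ⟪ p ⟫ (⟦ r ⟧ ρ)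
⟦substitute⟧ (con c) r ρ = refl
⟦substitute⟧ arg     r ρ = refl
⟦substitute⟧ (p ⊞ q) r ρ = cong₂ _+_ (⟦substitute⟧ p r ρ) (⟦substitute⟧ q r ρ)
⟦substitute⟧ (p ⊠ q) r ρ = cong₂ _*_ (⟦substitute⟧ p r ρ) (⟦substitute⟧ q r ρ)
⟦substitute⟧ (p ⊚ q) r ρ =
  trans (⟦substitute⟧ p (substitute q r) ρ) (cong ⟪ p ⟫ (⟦substitute⟧ q r ρ))

-- Functions computed on one variable

1≤size : ∀ t → 1 ≤ size t
1≤size nil        = s≤s z≤n
1≤size (cons s t) = s≤s z≤n

size-head : ∀ t → size (head t) ≤ size t
size-head nil        = ≤-refl
size-head (cons s t) = m≤n⇒m≤1+n (m≤m+n (size s) (size t))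

size-tail : ∀ t → size (tail t) ≤ size t
size-tail nil        = ≤-refl
size-tail (cons s t) = m≤n⇒m≤1+n (m≤n+m (size t) (size s))

ifT : Tree → Tree → Tree → Tree
ifT nil        s t = t
ifT (cons _ _) s t = s

pattern X = 0F
pattern S = sucF 0F

-- Variable X holds the argument and the result, and variable S a stack
-- whose contents are restored.
Computes : Command 2 → (Tree → Tree) → (Tree → ℕ) → Set
Computes c f T = ∀ d s → ∃[ t ]
  ⟨ c , d ∷ s ∷ [] ⟩⇓ f d ∷ s ∷ [] in-time t × t ≤ T d

computes-≤ : ∀ {c f T T′} → (∀ d → T d ≤ T′ d) → Computes c f T → Computes c f T′
computes-≤ T≤T′ c⇓ d s with c⇓ d s
... | t , run , t≤ = t , run , ≤-trans t≤ (T≤T′ d)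

computes-⨾ : ∀ {b c f g T U} → Computes b f T → Computes c g U →
  Computes (b ⨾ c) (g ∘ f) (λ d → T d + U (f d))
computes-⨾ {f = f} b⇓ c⇓ d s with b⇓ d s | c⇓ (f d) s
... | t , run , t≤ | u , run′ , u≤ = t + u , seq run run′ , +-mono-≤ t≤ u≤

pairCode : Command 2 → Command 2 → Command 2
pairCode b c =
  S := cons (var X) (var S) ⨾ b ⨾
  -- `X` briefly pairs the saved argument with the first result, so that the two change places
  -- between `X` and the stack without a third variable.
  X := cons (hd (var S)) (var X) ⨾ S := cons (tl (var X)) (tl (var S)) ⨾ X := hd (var X) ⨾ c ⨾
  X := cons (hd (var S)) (var X) ⨾ S := tl (var S)

computes-pair : ∀ {b c f g T U} → Computes b f T → Computes c g U →
  Computes (pairCode b c) (λ d → cons (f d) (g d)) (λ d → 4 + (T d + (14 + (U d + 8))))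
computes-pair {f = f} b⇓ c⇓ d s with b⇓ d (cons d s) | c⇓ d (cons (f d) s)
... | t , run , t≤ | u , run′ , u≤ =
  _ ,
  seq assign (seq run (seq assign (seq assign (seq assign (seq run′ (seq assign assign)))))) ,
  +-monoʳ-≤ 4 (+-mono-≤ t≤ (+-monoʳ-≤ 14 (+-monoˡ-≤ 8 u≤)))

condCode : Command 2 → Command 2 → Command 2 → Command 2
condCode a b c =
  S := cons (var X) (var S) ⨾ a ⨾
  cond (var X) (X := hd (var S) ⨾ S := tl (var S) ⨾ b)
               (X := hd (var S) ⨾ S := tl (var S) ⨾ c)

computes-cond : ∀ {a b c e f g R T U} → Computes a e R → Computes b f T → Computes c g U →
  Computes (condCode a b c) (λ d → ifT (e d) (f d) (g d))
    (λ d → 4 + (R d + (8 + (T d + U d))))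
computes-cond {e = e} {T = T} {U} a⇓ b⇓ c⇓ d s with e d | a⇓ d (cons d s) | b⇓ d s | c⇓ d s
... | nil | r , run , r≤ | _ | u , run′ , u≤ =
  _ , seq assign (seq run (cond-false refl (seq assign (seq assign run′)))) ,
  +-monoʳ-≤ 4 (+-mono-≤ r≤ (+-monoʳ-≤ 8 (≤-trans u≤ (m≤n+m (U d) (T d)))))
... | cons _ _ | r , run , r≤ | t , run′ , t≤ | _ =
  _ , seq assign (seq run (cond-true (λ ()) (seq assign (seq assign run′)))) ,
  +-monoʳ-≤ 4 (+-mono-≤ r≤ (+-monoʳ-≤ 8 (≤-trans t≤ (m≤m+n (T d) (U d)))))

-- Functions with polynomial running time and output size.

record Implementation (f : Tree → Tree) : Set where
  no-eta-equality
  field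
    code       : Command 2
    time space : Bound
    computes   : Computes code f (λ d → ⟪ time ⟫ (size d))
    size-fun   : ∀ d → size (f d) ≤ ⟪ space ⟫ (size d)

record Fn : Set where
  no-eta-equality
  constructor _by_
  field
    fun            : Tree → Tree
    implementation : Implementation fun

  open Implementation implementation public

open Fn public

size-ifT : ∀ c s t → size (ifT c s t) ≤ size s + size t
size-ifT nil        s t = m≤n+m (size t) (size s)
size-ifT (cons _ _) s t = m≤m+n (size s) (size t)

-- The step function receives the whole remaining list, so its head is
-- the current element.
foldT : (Tree → Tree → Tree) → Tree → Tree → Tree
foldT g nil        acc = acc
foldT g (cons h t) acc = foldT g t (g acc (cons h t))

-- Folding such a function stays within polynomial size, which iterating an
-- arbitrary polynomially bounded one need not do.
record Additive (f : Tree → Tree) : Set where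
  constructor _,_
  field
    growth : Bound
    grows  : ∀ acc e → size (f (cons acc e)) ≤ size acc + ⟪ growth ⟫ (size e)

open Additive public

loopCode : Command 2 → Command 2
loopCode c = while (hd (var X)) c

-- A loop state is cons xs (cons acc ρ).
module _ (a : Fn) (g : Tree → Tree → Tree) (ρ : Tree)
  (advances : ∀ h t acc → fun a (cons (cons h t) (cons acc ρ)) ≡ cons t (cons (g acc (cons h t)) ρ))
  (N : ℕ) (Inv : Tree → Tree → Set)
  (inv-step : ∀ h t acc → Inv (cons h t) acc → Inv t (g acc (cons h t)))
  (inv-size : ∀ xs acc → Inv xs acc → size (cons xs (cons acc ρ)) ≤ N)
  where

  -- Cons cells outnumber iterations, so size xs bounds their number.
  loop-computes : ∀ xs acc → Inv xs acc → ∀ s → ∃[ t ]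
    ⟨ loopCode (code a) , cons xs (cons acc ρ) ∷ s ∷ [] ⟩⇓
      cons nil (cons (foldT g xs acc) ρ) ∷ s ∷ [] in-time t ×
    t ≤ size xs * (3 + ⟪ time a ⟫ N)
  loop-computes nil acc inv s =
    3 , while-false refl , ≤-trans (m≤m+n 3 (⟪ time a ⟫ N)) (m≤m+n (3 + ⟪ time a ⟫ N) 0)
  loop-computes (cons h t) acc inv s
    with computes a (cons (cons h t) (cons acc ρ)) s
       | loop-computes t (g acc (cons h t)) (inv-step h t acc inv) s
  ... | r , run , r≤ | u , run′ , u≤ =
    _ ,
    while-true (λ ())
      (subst (λ d → ⟨ code a , _ ⟩⇓ d ∷ s ∷ [] in-time r) (advances h t acc) run) run′ ,
    +-mono-≤ (+-monoʳ-≤ 3 (≤-trans r≤ (⟪⟫-mono (time a) (inv-size _ _ inv))))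
      (≤-trans u≤ (*-monoˡ-≤ (3 + ⟪ time a ⟫ N) (m≤n+m (size t) (size h))))

-- Only the implementations are opaque. The field `fun` of a function built from them still reduces,
-- on which the correctness proofs rely.
abstract

  id-impl : Implementation id
  id-impl = record
    { code = X := var X ; time = con 2 ; space = arg
    ; computes = λ d s → 2 , assign , ≤-refl
    ; size-fun = λ d → ≤-refl
    }

  nil-impl : Implementation (λ _ → nil)
  nil-impl = record
    { code = X := nil ; time = con 2 ; space = con 1
    ; computes = λ d s → 2 , assign , ≤-refl
    ; size-fun = λ d → ≤-refl
    }

  head-impl : Implementation head
  head-impl = record
    { code = X := hd (var X) ; time = con 3 ; space = arg
    ; computes = λ d s → 3 , assign , ≤-refl
    ; size-fun = size-head
    }

  tail-impl : Implementation tail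
  tail-impl = record
    { code = X := tl (var X) ; time = con 3 ; space = arg
    ; computes = λ d s → 3 , assign , ≤-refl
    ; size-fun = size-tail
    }

  ∘-impl : ∀ g f → Implementation (fun g ∘ fun f)
  ∘-impl g f = record
    { code = code f ⨾ code g
    ; time = time f ⊞ time g ⊚ space f
    ; space = space g ⊚ space f
    ; computes = computes-≤ (λ d → +-monoʳ-≤ (⟪ time f ⟫ (size d)) (⟪⟫-mono (time g) (size-fun f d)))
        (computes-⨾ (computes f) (computes g))
    ; size-fun = λ d → ≤-trans (size-fun g (fun f d)) (⟪⟫-mono (space g) (size-fun f d))
    }

  cons-impl : ∀ f g → Implementation (λ d → cons (fun f d) (fun g d))
  cons-impl f g = record
    { code = pairCode (code f) (code g)
    ; time = con 4 ⊞ (time f ⊞ (con 14 ⊞ (time g ⊞ con 8)))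
    ; space = con 1 ⊞ (space f ⊞ space g)
    ; computes = computes-pair (computes f) (computes g)
    ; size-fun = λ d → s≤s (+-mono-≤ (size-fun f d) (size-fun g d))
    }

  if-impl : ∀ e f g → Implementation (λ d → ifT (fun e d) (fun f d) (fun g d))
  if-impl e f g = record
    { code = condCode (code e) (code f) (code g)
    ; time = con 4 ⊞ (time e ⊞ (con 8 ⊞ (time f ⊞ time g)))
    ; space = space f ⊞ space g
    ; computes = computes-cond (computes e) (computes f) (computes g)
    ; size-fun = λ d → ≤-trans (size-ifT (fun e d) (fun f d) (fun g d))
        (+-mono-≤ (size-fun f d) (size-fun g d))
    }

idᶠ nilᶠ : Fn
idᶠ  = id by id-impl
nilᶠ = (λ _ → nil) by nil-impl

infixr 9 _∘ᶠ_
_∘ᶠ_ : Fn → Fn → Fn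
g ∘ᶠ f = (fun g ∘ fun f) by ∘-impl g f

hdᶠ tlᶠ : Fn → Fn
hdᶠ f = (head by head-impl) ∘ᶠ f
tlᶠ f = (tail by tail-impl) ∘ᶠ f

consᶠ : Fn → Fn → Fn
consᶠ f g = (λ d → cons (fun f d) (fun g d)) by cons-impl f g

ifᶠ : Fn → Fn → Fn → Fn
ifᶠ e f g = (λ d → ifT (fun e d) (fun f d) (fun g d)) by if-impl e f g

advance : Fn → Fn
advance b = consᶠ (tlᶠ (hdᶠ idᶠ))
  (consᶠ (b ∘ᶠ consᶠ (hdᶠ (tlᶠ idᶠ)) (consᶠ (hdᶠ idᶠ) (tlᶠ (tlᶠ idᶠ)))) (tlᶠ (tlᶠ idᶠ)))

stepT : Fn → Tree → Tree → Tree → Tree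
stepT b ρ acc xs = fun b (cons acc (cons xs ρ))

-- Amortisation: a step adds at most `q` to the accumulator and removes at least one cons cell from
-- the list, so the accumulator plus `q` per unit of remaining list never increases.
fold-grow : ∀ b p → (∀ acc e → size (fun b (cons acc e)) ≤ size acc + ⟪ p ⟫ (size e)) →
  ∀ ρ {N R} → size ρ ≤ R → ∀ h t acc → size (cons h t) ≤ N →
  let q = ⟪ p ⟫ (1 + (N + R)) in
  size (stepT b ρ acc (cons h t)) + size t * q ≤ size acc + size (cons h t) * q
fold-grow b p grow ρ {N} {R} ρ≤ h t acc xs≤ = begin
  size (stepT b ρ acc (cons h t)) + size t * q
    ≤⟨ +-monoˡ-≤ (size t * q) (≤-trans (grow acc (cons (cons h t) ρ))
         (+-monoʳ-≤ (size acc) (⟪⟫-mono p (+-mono-≤ (≤-refl {1}) (+-mono-≤ xs≤ ρ≤))))) ⟩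
  size acc + q + size t * q       ≡⟨ +-assoc (size acc) q _ ⟩
  size acc + (q + size t * q)
    ≤⟨ +-monoʳ-≤ (size acc) (*-monoˡ-≤ q (s≤s (m≤n+m (size t) (size h)))) ⟩
  size acc + size (cons h t) * q  ∎
  where
  open ≤-Reasoning
  q = ⟪ p ⟫ (1 + (N + R))

size-tail-≤ : ∀ h t {N} → size (cons h t) ≤ N → size t ≤ N
size-tail-≤ h t = ≤-trans (size-tail (cons h t))

module Fold (b : Fn) (p : Bound)
  (grow : ∀ acc e → size (fun b (cons acc e)) ≤ size acc + ⟪ p ⟫ (size e)) (l i r : Fn)
  where

  start a : Fn
  start = consᶠ l (consᶠ i r)
  a     = advance b

  inc states : Bound
  inc    = p ⊚ (con 1 ⊞ (space l ⊞ space r))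
  states = con 1 ⊞ (space l ⊞ (con 1 ⊞ ((space i ⊞ space l ⊠ inc) ⊞ space r)))

  module _ (d : Tree) where

    private
      g = stepT b (fun r d)
      q = ⟪ inc ⟫ (size d)

    Inv : Tree → Tree → Set
    Inv xs acc = size xs ≤ size (fun l d) ×
      size acc + size xs * q ≤ size (fun i d) + size (fun l d) * q

    inv-step : ∀ h t acc → Inv (cons h t) acc → Inv t (g acc (cons h t))
    inv-step h t acc (xs≤ , acc≤) = size-tail-≤ h t xs≤ ,
      ≤-trans (fold-grow b p grow (fun r d) (size-fun r d) h t acc (≤-trans xs≤ (size-fun l d))) acc≤

    inv-acc : ∀ xs acc → Inv xs acc → size acc ≤ ⟪ space i ⊞ space l ⊠ inc ⟫ (size d)
    inv-acc xs acc (_ , acc≤) = ≤-trans (m≤m+n (size acc) (size xs * q))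
      (≤-trans acc≤ (+-mono-≤ (size-fun i d) (*-monoˡ-≤ q (size-fun l d))))

    inv-size : ∀ xs acc → Inv xs acc →
      size (cons xs (cons acc (fun r d))) ≤ ⟪ states ⟫ (size d)
    inv-size xs acc inv = +-mono-≤ (≤-refl {1}) (+-mono-≤ (≤-trans (proj₁ inv) (size-fun l d))
      (+-mono-≤ (≤-refl {1}) (+-mono-≤ (inv-acc xs acc inv) (size-fun r d))))

    inv-end : ∀ xs acc → Inv xs acc → Inv nil (foldT g xs acc)
    inv-end nil        acc inv = inv
    inv-end (cons h t) acc inv = inv-end t _ (inv-step h t acc inv)

    inv-start : Inv (fun l d) (fun i d)
    inv-start = ≤-refl , ≤-refl

  duration extent : Bound
  duration = time start ⊞ (space l ⊠ (con 3 ⊞ time a ⊚ states) ⊞ con 4)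
  extent   = space i ⊞ space l ⊠ inc

  value : Tree → Tree
  value d = foldT (stepT b (fun r d)) (fun l d) (fun i d)

  loop-runs : Computes (code start ⨾ loopCode (code a) ⨾ X := hd (tl (var X))) value
    (λ d → ⟪ duration ⟫ (size d))
  loop-runs d s = let
      t , run , t≤ = computes start d s
      u , run′ , u≤ = loop-computes a (stepT b (fun r d)) (fun r d) (λ h t acc → refl)
        (⟪ states ⟫ (size d)) (Inv d) (inv-step d) (inv-size d) (fun l d) (fun i d) (inv-start d) s
    in _ , seq run (seq run′ assign) ,
       +-mono-≤ t≤ (+-monoˡ-≤ 4
         (≤-trans u≤ (*-monoˡ-≤ (3 + ⟪ time a ⟫ (⟪ states ⟫ (size d))) (size-fun l d))))

  value-size : ∀ d → size (value d) ≤ ⟪ extent ⟫ (size d)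
  value-size d = inv-acc d nil _ (inv-end d _ _ (inv-start d))

  loop : Implementation value
  loop = record
    { code = code start ⨾ loopCode (code a) ⨾ X := hd (tl (var X))
    ; time = duration
    ; space = extent
    ; computes = loop-runs
    ; size-fun = value-size
    }

abstract

  fold-impl : ∀ b → Additive (fun b) → ∀ l i r →
    Implementation (λ d → foldT (stepT b (fun r d)) (fun l d) (fun i d))
  fold-impl b (p , grow) = Fold.loop b p grow

foldᶠ : ∀ b → Additive (fun b) → Fn → Fn → Fn → Fn
foldᶠ b add l i r = (λ d → foldT (stepT b (fun r d)) (fun l d) (fun i d)) by fold-impl b add l i r

-- Provability and closure under shifted rules

private
  variable
    n : ℕ

infixl 6 _≫_
_≫_ : TimedAttribute n → ℤ → TimedAttribute n
(y , i) ≫ j = y , i ℤ.+ j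

≫-0 : (p : TimedAttribute n) → p ≫ 0ℤ ≡ p
≫-0 (y , i) = cong (y ,_) (ℤ.+-identityʳ i)

≫-≫ : (p : TimedAttribute n) → ∀ i j → p ≫ i ≫ j ≡ p ≫ (i ℤ.+ j)
≫-≫ (y , k) i j = cong (y ,_) (ℤ.+-assoc k i j)

data Closure (T : FiniteTheory n) (A : FiniteSubset n) : TimedAttribute n → Set where
  base : ∀ {p} → p ∈ A → Closure T A p
  step : ∀ {φ} → φ ∈ T → ∀ j → (∀ {p} → p ∈ antecedent φ → Closure T A (p ≫ j)) →
         ∀ {q} → q ∈ consequent φ → Closure T A (q ≫ j)

module _ {n} {T : FiniteTheory n} where

  closure-trans : ∀ {A B} → (∀ {p} → p ∈ B → Closure T A p) → ∀ {p} → Closure T B p → Closure T A p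
  closure-trans B≤ (base p∈B)          = B≤ p∈B
  closure-trans B≤ (step φ∈T j E≤ q∈F) = step φ∈T j (λ p∈E → closure-trans B≤ (E≤ p∈E)) q∈F

  closure-shift : ∀ {A} i → ∀ {p} → Closure T A p → Closure T (A ⊕ i) (p ≫ i)
  closure-shift i (base p∈A) = base (∈-map⁺ (_≫ i) p∈A)
  closure-shift {A} i (step {φ} φ∈T j E≤ {q} q∈F) =
    subst (Closure T (A ⊕ i)) (sym (≫-≫ q j i))
      (step φ∈T (j ℤ.+ i)
        (λ {p} p∈E → subst (Closure T (A ⊕ i)) (≫-≫ p j i) (closure-shift i (E≤ p∈E))) q∈F)

  Holds : Formula n → Set
  Holds (A ⇒ B) = ∀ {p} → p ∈ B → Closure T A p

  holds-≈ : ∀ {φ ψ} → φ ≈ ψ → Holds ψ → Holds φ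
  holds-≈ (A≈ , B≈) h p∈B =
    closure-trans (base ∘ Equivalence.from A≈) (h (Equivalence.to B≈ p∈B))

  holds-∈ᶠ : ∀ {φ Γ} → φ ∈ᶠ Γ → (∀ {ψ} → ψ ∈ Γ → Holds ψ) → Holds φ
  holds-∈ᶠ φ∈Γ h with find φ∈Γ
  ... | ψ , ψ∈Γ , φ≈ψ = holds-≈ φ≈ψ (h ψ∈Γ)

  holds-theory : ∀ {φ} → φ ∈ T → Holds φ
  holds-theory φ∈T {p} p∈B = subst (Closure T _) (≫-0 p)
    (step φ∈T 0ℤ (λ {q} q∈E → subst (Closure T _) (sym (≫-0 q)) (base q∈E)) p∈B)

  holds-follows : ∀ {Γ φ} → (∀ {ψ} → ψ ∈ Γ → Holds ψ) → FollowsFrom Γ φ → Holds φ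
  holds-follows h (ax A B) p∈A = base (∈-++⁺ˡ p∈A)
  holds-follows h (cut A B C D AB∈ BCD∈) p∈D =
    closure-trans
      ([ closure-trans (base ∘ ∈-++⁺ˡ) ∘ holds-∈ᶠ AB∈ h , base ∘ ∈-++⁺ʳ A ]′ ∘ ∈-++⁻ B)
      (holds-∈ᶠ BCD∈ h p∈D)
  holds-follows h (shf A B i AB∈) p∈B with ∈-map⁻ (_≫ i) p∈B
  ... | q , q∈B , refl = closure-shift i (holds-∈ᶠ AB∈ h q∈B)

  holds-deduction : ∀ {Γ} → IsDeduction T Γ → ∀ {ψ} → ψ ∈ Γ → Holds ψ
  holds-deduction (hyp φ∈T Γ)       (here refl) = holds-∈ᶠ φ∈T holds-theory
  holds-deduction (hyp φ∈T Γ)       (there ψ∈)  = holds-deduction Γ ψ∈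
  holds-deduction (follow φ≈ φ⇐ Γ)  (here refl) = holds-≈ φ≈ (holds-follows (holds-deduction Γ) φ⇐)
  holds-deduction (follow φ≈ φ⇐ Γ)  (there ψ∈)  = holds-deduction Γ ψ∈

  ⊢-sound : ∀ {A B} → T ⊢ A ⇒ B → ∀ {p} → p ∈ B → Closure T A p
  ⊢-sound (Γ , d) = holds-deduction d (here refl)

  private
    module SetEq = Setoid ([ set ]-Equality (TimedAttribute n))

  ≈-refl : {φ : Formula n} → φ ≈ φ
  ≈-refl = SetEq.refl , SetEq.refl

  ≈-trans : {φ ψ χ : Formula n} → φ ≈ ψ → ψ ≈ χ → φ ≈ χ
  ≈-trans (a , b) (c , d) = SetEq.trans a c , SetEq.trans b d

  follows-⊆ : ∀ {Γ Δ : List (Formula n)} {φ} → (∀ {ψ} → ψ ∈ᶠ Γ → ψ ∈ᶠ Δ) → FollowsFrom Γ φ → FollowsFrom Δ φ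
  follows-⊆ Γ⊆Δ (ax A B)          = ax A B
  follows-⊆ Γ⊆Δ (cut A B C D p q) = cut A B C D (Γ⊆Δ p) (Γ⊆Δ q)
  follows-⊆ Γ⊆Δ (shf A B i p)     = shf A B i (Γ⊆Δ p)

  deduction-++ : ∀ {Γ Δ} → IsDeduction T Γ → IsDeduction T Δ → IsDeduction T (Γ ++ Δ)
  deduction-++ []             e = e
  deduction-++ (hyp φ∈ d)     e = hyp φ∈ (deduction-++ d e)
  deduction-++ (follow φ≈ f d) e = follow φ≈ (follows-⊆ ++⁺ˡ f) (deduction-++ d e)

  ⊢-≈ : ∀ {φ ψ} → φ ≈ ψ → T ⊢ ψ → T ⊢ φ
  ⊢-≈ {φ} {ψ} φ≈ψ (Γ , hyp ψ∈ d)      = Γ , hyp (Any.map (λ {χ} → ≈-trans {φ} {ψ} {χ} φ≈ψ) ψ∈) d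
  ⊢-≈ {φ} {ψ} φ≈ψ (Γ , follow {ψ = χ} ψ≈ f d) =
    Γ , follow (≈-trans {φ} {ψ} {χ} φ≈ψ ψ≈) f d

  ⊢-cut : ∀ {A B C D} → T ⊢ A ⇒ B → T ⊢ B ++ C ⇒ D → T ⊢ A ++ C ⇒ D
  ⊢-cut {A} {B} {C} {D} (Γ , d) (Δ , e) =
    _ , follow ≈-refl (cut A B C D (here ≈-refl) (++⁺ʳ ((A ⇒ B) ∷ Γ) (here ≈-refl)))
          (deduction-++ d e)

  ⊢-shift : ∀ {A B} i → T ⊢ A ⇒ B → T ⊢ A ⊕ i ⇒ B ⊕ i
  ⊢-shift {A} {B} i (Γ , d) = _ , follow ≈-refl (shf A B i (here ≈-refl)) d

  ⊢-⊆ : ∀ {A B} → B ⊆ A → T ⊢ A ⇒ B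
  ⊢-⊆ {A} {B} B⊆A =
    [] , follow (mk⇔ (∈-++⁺ʳ B) ([ B⊆A , id ]′ ∘ ∈-++⁻ B) , SetEq.refl) (ax B A) []

  ⊢-trans : ∀ {A B C} → T ⊢ A ⇒ B → T ⊢ B ⇒ C → T ⊢ A ⇒ C
  ⊢-trans {A} {B} {C} AB BC =
    subst (λ A → T ⊢ A ⇒ C) (++-identityʳ A)
      (⊢-cut AB (subst (λ B → T ⊢ B ⇒ C) (sym (++-identityʳ B)) BC))

  -- Two cuts into B ∪ C ⇒ B ∪ C replace first B and then C by A; the resulting antecedent A ∪ A is
  -- the same set as A.
  ⊢-++ : ∀ {A B C} → T ⊢ A ⇒ B → T ⊢ A ⇒ C → T ⊢ A ⇒ B ++ C
  ⊢-++ {A} {B} {C} AB AC =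
    ⊢-≈ (mk⇔ ∈-++⁺ˡ ([ id , id ]′ ∘ ∈-++⁻ A) , SetEq.refl)
      (⊢-cut AC (⊢-≈ (mk⇔ ([ ∈-++⁺ʳ A , ∈-++⁺ˡ ]′ ∘ ∈-++⁻ C) ([ ∈-++⁺ʳ C , ∈-++⁺ˡ ]′ ∘ ∈-++⁻ A) , SetEq.refl)
        (⊢-cut AB (⊢-⊆ id))))

  ⊢-All : ∀ {A} B → (∀ {p} → p ∈ B → T ⊢ A ⇒ p ∷ []) → T ⊢ A ⇒ B
  ⊢-All []      h = ⊢-⊆ (λ ())
  ⊢-All (p ∷ B) h = ⊢-++ (h (here refl)) (⊢-All B (h ∘ there))

  ⊢-closure : ∀ {A p} → Closure T A p → T ⊢ A ⇒ p ∷ []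
  ⊢-closure (base p∈A) = ⊢-⊆ λ { (here refl) → p∈A }
  ⊢-closure {A} (step {φ} φ∈T j E≤ q∈F) =
    ⊢-trans (⊢-All (antecedent φ ⊕ j) λ p∈ → shifted (∈-map⁻ (_≫ j) p∈))
      (⊢-trans (⊢-shift j ([] , hyp (lose φ∈T ≈-refl) []))
        (⊢-⊆ λ { (here refl) → ∈-map⁺ (_≫ j) q∈F }))
    where
    shifted : ∀ {p} → ∃[ q ] (q ∈ antecedent φ × p ≡ q ≫ j) → T ⊢ A ⇒ p ∷ []
    shifted (q , q∈E , refl) = ⊢-closure (E≤ q∈E)

  ⊢-complete : ∀ {A B} → (∀ {p} → p ∈ B → Closure T A p) → T ⊢ A ⇒ B
  ⊢-complete {B = B} h = ⊢-All B (⊢-closure ∘ h)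

  -- Following one premise of each step leads back to `A` without ever moving forward in time; there
  -- is a premise to follow because antecedents of predictive formulas are non-empty.
  closure-≥ : All Predictive T → ∀ {A l} → (∀ {p} → p ∈ A → l ℤ.≤ proj₂ p) →
    ∀ {p} → Closure T A p → l ℤ.≤ proj₂ p
  closure-≥ pred l≤ (base p∈A) = l≤ p∈A
  closure-≥ pred l≤ (step φ∈T j E≤ q∈F) with All.lookup pred φ∈T
  closure-≥ pred l≤ (step {[] ⇒ F} φ∈T j E≤ q∈F) | A≢[] , _ , _ = contradiction refl A≢[]
  closure-≥ pred l≤ (step {(p ∷ E) ⇒ F} φ∈T j E≤ q∈F) | _ , _ , E≤F =
    ℤ.≤-trans (closure-≥ pred l≤ (E≤ (here refl))) (ℤ.+-monoˡ-≤ j (E≤F (here refl) q∈F))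

-- Functions additive in an accumulator

additive-head : Additive head
additive-head = con 0 , λ acc e → m≤m+n (size acc) 0

additive-tail : Additive (λ d → tail (head d))
additive-tail = con 0 , λ acc e → ≤-trans (size-tail acc) (m≤m+n (size acc) 0)

-- For use in the body of a fold, whose argument is `cons acc e`: the result does not depend on the
-- accumulator.
wk : Fn → Fn
wk f = f ∘ᶠ tlᶠ idᶠ

additive-wk : ∀ f → Additive (fun (wk f))
additive-wk f = space f , λ acc e → ≤-trans (size-fun f e) (m≤n+m _ (size acc))

-- The test may inspect the accumulator freely, as only the branches contribute to the size. This
-- lets a rule look up its premises among the facts while still being additive in them.
additive-if : ∀ (e : Tree → Tree) {f g} → Additive f → Additive g → Additive (λ d → ifT (e d) (f d) (g d))
additive-if e {f} {g} (p , f≤) (q , g≤) = p ⊞ q , grow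
  where
  grow : ∀ acc d → size (ifT (e (cons acc d)) (f (cons acc d)) (g (cons acc d))) ≤
    size acc + (⟪ p ⟫ (size d) + ⟪ q ⟫ (size d))
  grow acc d with e (cons acc d)
  ... | nil      = ≤-trans (g≤ acc d) (+-monoʳ-≤ (size acc) (m≤n+m _ (⟪ p ⟫ (size d))))
  ... | cons _ _ = ≤-trans (f≤ acc d) (+-monoʳ-≤ (size acc) (m≤m+n (⟪ p ⟫ (size d)) _))

additive-cons : ∀ f {g} → Additive g → Additive (λ d → cons (fun f (tail d)) (g d))
additive-cons f {g} (p , g≤) = con 1 ⊞ space f ⊞ p , λ acc e → begin
  1 + (size (fun f e) + size (g (cons acc e)))
    ≤⟨ s≤s (+-mono-≤ (size-fun f e) (g≤ acc e)) ⟩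
  1 + (⟪ space f ⟫ (size e) + (size acc + ⟪ p ⟫ (size e)))
    ≡⟨ middle (⟪ space f ⟫ (size e)) (size acc) (⟪ p ⟫ (size e)) ⟩
  size acc + (1 + ⟪ space f ⟫ (size e) + ⟪ p ⟫ (size e)) ∎
  where
  open ≤-Reasoning
  middle : ∀ a b c → 1 + (a + (b + c)) ≡ b + (1 + a + c)
  middle = ℕSolver.solve-∀

-- Makes nested folds possible: the list and the environment come from `tail d`, so neither the
-- number of iterations nor the growth in each of them depends on the accumulator.
additive-fold : ∀ b → Additive (fun b) → ∀ l r {i} → Additive i →
  Additive (λ d → foldT (stepT b (fun r (tail d))) (fun l (tail d)) (i d))
additive-fold b (p , grow) l r {i} (q , i≤) = q ⊞ space l ⊠ inc , bound
  where
  open ≤-Reasoning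
  inc : Bound
  inc = p ⊚ (con 1 ⊞ (space l ⊞ space r))
  result : ∀ e xs acc → size xs ≤ ⟪ space l ⟫ (size e) →
    size (foldT (stepT b (fun r e)) xs acc) ≤ size acc + size xs * ⟪ inc ⟫ (size e)
  result e nil        acc xs≤ = m≤m+n (size acc) _
  result e (cons h t) acc xs≤ = ≤-trans (result e t _ (size-tail-≤ h t xs≤))
    (fold-grow b p grow (fun r e) (size-fun r e) h t acc xs≤)
  bound : ∀ acc e → size (foldT (stepT b (fun r e)) (fun l e) (i (cons acc e))) ≤
    size acc + (⟪ q ⟫ (size e) + ⟪ space l ⟫ (size e) * ⟪ inc ⟫ (size e))
  bound acc e = begin
    size (foldT (stepT b (fun r e)) (fun l e) (i (cons acc e)))
      ≤⟨ result e (fun l e) (i (cons acc e)) (size-fun l e) ⟩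
    size (i (cons acc e)) + size (fun l e) * ⟪ inc ⟫ (size e)
      ≤⟨ +-mono-≤ (i≤ acc e) (*-monoˡ-≤ (⟪ inc ⟫ (size e)) (size-fun l e)) ⟩
    size acc + ⟪ q ⟫ (size e) + ⟪ space l ⟫ (size e) * ⟪ inc ⟫ (size e)
      ≡⟨ +-assoc (size acc) _ _ ⟩
    size acc + (⟪ q ⟫ (size e) + ⟪ space l ⟫ (size e) * ⟪ inc ⟫ (size e)) ∎

-- Algorithms as functions on trees

private
  arg₀ arg₁ : Fn
  arg₀ = hdᶠ idᶠ
  arg₁ = tlᶠ idᶠ

trueᶠ : Fn
trueᶠ = consᶠ nilᶠ nilᶠ

notᶠ : Fn → Fn
notᶠ f = ifᶠ f nilᶠ trueᶠ

infixr 6 _∧ᶠ_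
_∧ᶠ_ : Fn → Fn → Fn
f ∧ᶠ g = ifᶠ f g nilᶠ

-- The function mapped over a list receives cons x ρ for the element x
-- and the environment ρ.
onHead : Fn → Fn
onHead p = wk (p ∘ᶠ consᶠ (hdᶠ arg₀) arg₁)

allᶠ anyᶠ : Fn → Fn → Fn → Fn
allᶠ p l r = foldᶠ (arg₀ ∧ᶠ onHead p)
  (additive-if head (additive-wk (p ∘ᶠ consᶠ (hdᶠ arg₀) arg₁)) (additive-wk nilᶠ)) l trueᶠ r
anyᶠ p l r = foldᶠ (ifᶠ arg₀ trueᶠ (onHead p))
  (additive-if head (additive-wk trueᶠ) (additive-wk (p ∘ᶠ consᶠ (hdᶠ arg₀) arg₁))) l nilᶠ r

collectStep : Fn → Fn
collectStep h = consᶠ (onHead h) arg₀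

additive-collectStep : ∀ h → Additive (fun (collectStep h))
additive-collectStep h = additive-cons (h ∘ᶠ consᶠ (hdᶠ arg₀) arg₁) additive-head

collectᶠ : Fn → Fn → Fn → Fn → Fn
collectᶠ h = foldᶠ (collectStep h) (additive-collectStep h)

-- Any list serves as the unary number that is its length; the entries are irrelevant, and `eqᶠ`
-- compares lengths only.
subᶠ addᶠ leqᶠ eqᶠ : Fn
subᶠ = foldᶠ (tlᶠ arg₀) additive-tail arg₁ arg₀ nilᶠ
addᶠ = foldᶠ (consᶠ nilᶠ arg₀) (additive-cons nilᶠ additive-head) arg₁ arg₀ nilᶠ
leqᶠ = notᶠ subᶠ
eqᶠ  = leqᶠ ∧ᶠ leqᶠ ∘ᶠ consᶠ arg₁ arg₀

additive-add : Additive (fun addᶠ)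
additive-add = additive-fold (consᶠ nilᶠ arg₀) (additive-cons nilᶠ additive-head) idᶠ nilᶠ additive-head

-- The list xs of weights 1, 2, 4, … is folded; the accumulator pairs the
-- digits not read yet with the value of those already read.
weight doubled readDigit valueStep : Fn
weight    = hdᶠ arg₀
doubled   = addᶠ ∘ᶠ consᶠ weight weight
readDigit = consᶠ (tlᶠ (hdᶠ arg₀))
  (addᶠ ∘ᶠ consᶠ (tlᶠ arg₀) (ifᶠ (hdᶠ (hdᶠ arg₀)) (wk doubled) (wk weight)))
valueStep = ifᶠ (hdᶠ arg₀) readDigit arg₀

additive-valueStep : Additive (fun valueStep)
additive-valueStep = additive-if (fun (hdᶠ arg₀)) {fun readDigit}
  (con 2 ⊞ p ⊚ (space doubled ⊞ space weight) , grow) additive-head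
  where
  p = growth additive-add
  -- The 2 is for `acc = nil`, which is enlarged when a pair is formed from its two projections.
  halves : ∀ acc → 1 + (size (tail (head acc)) + size (tail acc)) ≤ size acc + 2
  halves nil        = ≤-refl
  halves (cons s t) = ≤-trans (s≤s (+-monoˡ-≤ (size t) (size-tail s))) (m≤m+n _ 2)
  grow : ∀ acc e → let y = ifT (head (head acc)) (fun doubled e) (fun weight e) in
    size (cons (tail (head acc)) (fun addᶠ (cons (tail acc) y))) ≤
    size acc + (2 + ⟪ p ⟫ (⟪ space doubled ⟫ (size e) + ⟪ space weight ⟫ (size e)))
  grow acc e = begin
    1 + (size (tail (head acc)) + size (fun addᶠ (cons (tail acc) y)))
      ≤⟨ s≤s (+-monoʳ-≤ (size (tail (head acc))) (≤-trans (grows additive-add (tail acc) y)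
           (+-monoʳ-≤ (size (tail acc)) (⟪⟫-mono p
             (≤-trans (size-ifT (head (head acc)) (fun doubled e) (fun weight e))
               (+-mono-≤ (size-fun doubled e) (size-fun weight e))))))) ⟩
    1 + (size (tail (head acc)) + (size (tail acc) + Q))
      ≡⟨ +-assoc (1 + size (tail (head acc))) (size (tail acc)) Q ⟨
    1 + (size (tail (head acc)) + size (tail acc)) + Q
      ≤⟨ +-monoˡ-≤ Q (halves acc) ⟩
    size acc + 2 + Q
      ≡⟨ +-assoc (size acc) 2 Q ⟩
    size acc + (2 + Q) ∎
    where
    open ≤-Reasoning
    y = ifT (head (head acc)) (fun doubled e) (fun weight e)
    Q = ⟪ p ⟫ (⟪ space doubled ⟫ (size e) + ⟪ space weight ⟫ (size e))

-- arguments: numeral, weights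
valueᶠ : Fn
valueᶠ = tlᶠ (foldᶠ valueStep additive-valueStep arg₁ (consᶠ arg₀ nilᶠ) nilᶠ)

samePointᶠ memberᶠ : Fn
samePointᶠ = eqᶠ ∘ᶠ consᶠ (hdᶠ arg₀) (hdᶠ arg₁) ∧ᶠ eqᶠ ∘ᶠ consᶠ (tlᶠ arg₀) (tlᶠ arg₁)
memberᶠ    = anyᶠ samePointᶠ arg₁ arg₀

-- argument: cons x (cons V K), for the weights V and the offset K
convPointᶠ convSetᶠ convFormulaᶠ : Fn
convPointᶠ = consᶠ (hdᶠ arg₀) (ifᶠ (hdᶠ (tlᶠ arg₀)) (subᶠ ∘ᶠ consᶠ K v) (addᶠ ∘ᶠ consᶠ K v))
  where
  K = tlᶠ arg₁
  v = valueᶠ ∘ᶠ consᶠ (tlᶠ (tlᶠ arg₀)) (hdᶠ arg₁)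
convSetᶠ = collectᶠ convPointᶠ arg₀ nilᶠ arg₁
convFormulaᶠ = consᶠ (convSetᶠ ∘ᶠ consᶠ (hdᶠ arg₀) arg₁) (convSetᶠ ∘ᶠ consᶠ (tlᶠ arg₀) arg₁)

shiftPointᶠ shiftSetᶠ : Fn
shiftPointᶠ = consᶠ (hdᶠ arg₀) (addᶠ ∘ᶠ consᶠ (tlᶠ arg₀) arg₁)
shiftSetᶠ   = collectᶠ shiftPointᶠ arg₀ nilᶠ arg₁

predictiveᶠ : Fn
predictiveᶠ = arg₀ ∧ᶠ arg₁ ∧ᶠ allᶠ (allᶠ (leqᶠ ∘ᶠ consᶠ (tlᶠ arg₁) (tlᶠ arg₀)) arg₁ arg₀) arg₀ arg₁

-- argument: cons e (cons M j)
premiseᶠ : Fn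
premiseᶠ = memberᶠ ∘ᶠ consᶠ (shiftPointᶠ ∘ᶠ consᶠ arg₀ (tlᶠ arg₁)) (hdᶠ arg₁)

-- The rule at the head of xs is applied with shift j to the facts M; the
-- argument is cons M (cons xs j).
applyᶠ : Fn
applyᶠ = ifᶠ (allᶠ premiseᶠ (hdᶠ (hdᶠ (hdᶠ arg₁))) (consᶠ arg₀ (tlᶠ arg₁)))
  (collectᶠ shiftPointᶠ (wk (tlᶠ (hdᶠ arg₀))) arg₀ (wk arg₁)) arg₀

additive-apply : Additive (fun applyᶠ)
additive-apply = additive-if _
  (additive-fold (collectStep shiftPointᶠ) (additive-collectStep shiftPointᶠ)
    (tlᶠ (hdᶠ arg₀)) arg₁ additive-head)
  additive-head

-- argument: cons M (cons js Θ); the shift is the tail of js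
passᶠ : Fn
passᶠ = foldᶠ applyᶠ additive-apply (wk arg₁) arg₀ (wk (tlᶠ arg₀))

additive-pass : Additive (fun passᶠ)
additive-pass = additive-fold applyᶠ additive-apply arg₁ (tlᶠ arg₀) additive-head

-- argument: cons M (cons xs (cons Θ J))
sweepᶠ : Fn
sweepᶠ = foldᶠ passᶠ additive-pass (wk (tlᶠ arg₁)) arg₀ (wk (hdᶠ arg₁))

additive-sweep : Additive (fun sweepᶠ)
additive-sweep = additive-fold passᶠ additive-pass (tlᶠ arg₁) (hdᶠ arg₁) additive-head

copiesᶠ : ℕ → Fn
copiesᶠ zero    = nilᶠ
copiesᶠ (suc n) = addᶠ ∘ᶠ consᶠ idᶠ (copiesᶠ n)

-- argument: cons A (cons Θ J)
saturateᶠ : ℕ → Fn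
saturateᶠ n = foldᶠ sweepᶠ additive-sweep (copiesᶠ n ∘ᶠ tlᶠ arg₁) arg₀ arg₁

-- argument: cons (cons A B) (cons Θ J)
answerᶠ : ℕ → Fn
answerᶠ n = predictiveᶠ ∘ᶠ arg₀ ∧ᶠ allᶠ (predictiveᶠ ∘ᶠ arg₀) (hdᶠ arg₁) nilᶠ ∧ᶠ
  allᶠ memberᶠ (tlᶠ arg₀) (saturateᶠ n ∘ᶠ consᶠ (hdᶠ arg₀) arg₁)

-- The argument is cons d W for an instance d and the descending powers W
-- of 2; facts have offset 3K and rules offset K.
mainᶠ : ℕ → Fn
mainᶠ n = (answerᶠ n ∘ᶠ
    consᶠ (consᶠ (shiftSetᶠ ∘ᶠ consᶠ (hdᶠ φ) 2K) (shiftSetᶠ ∘ᶠ consᶠ (tlᶠ φ) 2K))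
      -- The extra cell in front of 4K gives `J` the length 4K + 1, so that its proper tails have
      -- the lengths 0, ..., 4K.
      (consᶠ (tlᶠ arg₀) (consᶠ nilᶠ (addᶠ ∘ᶠ consᶠ 2K 2K))))
  ∘ᶠ consᶠ (consᶠ (convFormulaᶠ ∘ᶠ consᶠ (tlᶠ arg₀) arg₁)
      (collectᶠ convFormulaᶠ (hdᶠ arg₀) nilᶠ arg₁))
    (tlᶠ arg₁)
  -- Collecting reverses the descending powers into the weights 1, 2, 4, ...; doubling the largest
  -- power gives `K`.
  ∘ᶠ consᶠ arg₀ (consᶠ (collectᶠ arg₀ arg₁ nilᶠ nilᶠ) (addᶠ ∘ᶠ consᶠ (hdᶠ arg₁) (hdᶠ arg₁)))
  where
  φ 2K : Fn
  φ  = hdᶠ arg₀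
  2K = addᶠ ∘ᶠ consᶠ arg₁ arg₁

longerPoint : Fn
longerPoint = ifᶠ (subᶠ ∘ᶠ consᶠ (wk digits) arg₀) (wk digits) arg₀
  where
  digits = tlᶠ (tlᶠ (hdᶠ arg₀))

additive-longerPoint : Additive (fun longerPoint)
additive-longerPoint = additive-if _ (additive-wk (tlᶠ (tlᶠ (hdᶠ arg₀)))) additive-head

longerInAntecedent longerFormula : Fn
longerInAntecedent =
  foldᶠ longerPoint additive-longerPoint (wk (hdᶠ (hdᶠ arg₀))) arg₀ (wk nilᶠ)
longerFormula =
  foldᶠ longerPoint additive-longerPoint (wk (tlᶠ (hdᶠ arg₀))) longerInAntecedent (wk nilᶠ)

additive-longerFormula : Additive (fun longerFormula)
additive-longerFormula =
  additive-fold longerPoint additive-longerPoint (tlᶠ (hdᶠ arg₀)) nilᶠ {i = fun longerInAntecedent}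
    (additive-fold longerPoint additive-longerPoint (hdᶠ (hdᶠ arg₀)) nilᶠ additive-head)

-- An encoded theory followed by a formula, with the components swapped, is the encoded list
-- `φ ∷ T`.
formulasᶠ : Fn
formulasᶠ = consᶠ arg₁ arg₀

longestᶠ : Fn
longestᶠ = foldᶠ longerFormula additive-longerFormula formulasᶠ nilᶠ nilᶠ

-- Recognisers of encodings.

isBoolᶠ isIntegerᶠ : Fn
isBoolᶠ    = ifᶠ idᶠ (notᶠ arg₀ ∧ᶠ notᶠ arg₁) trueᶠ
-- The last conjunct rejects negative zero, which encodes no integer.
isIntegerᶠ = idᶠ ∧ᶠ isBoolᶠ ∘ᶠ arg₀ ∧ᶠ allᶠ (isBoolᶠ ∘ᶠ arg₀) arg₁ nilᶠ ∧ᶠ ifᶠ arg₀ arg₁ trueᶠ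

isAttributeᶠ isPointᶠ isSetᶠ isFormulaᶠ isInstanceᶠ : ℕ → Fn
isAttributeᶠ zero    = nilᶠ
isAttributeᶠ (suc n) = ifᶠ idᶠ (notᶠ arg₀ ∧ᶠ isAttributeᶠ n ∘ᶠ arg₁) trueᶠ
isPointᶠ n    = idᶠ ∧ᶠ isAttributeᶠ n ∘ᶠ arg₀ ∧ᶠ isIntegerᶠ ∘ᶠ arg₁
isSetᶠ n      = allᶠ (isPointᶠ n ∘ᶠ arg₀) idᶠ nilᶠ
isFormulaᶠ n  = idᶠ ∧ᶠ isSetᶠ n ∘ᶠ arg₀ ∧ᶠ isSetᶠ n ∘ᶠ arg₁
isInstanceᶠ n = idᶠ ∧ᶠ allᶠ (isFormulaᶠ n ∘ᶠ arg₀) formulasᶠ nilᶠ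

-- Correctness of lists and unary arithmetic

nil-or-truthy : ∀ t → t ≡ nil ⊎ Truthy t
nil-or-truthy nil        = inj₁ refl
nil-or-truthy (cons s t) = inj₂ λ ()

∧-elim : ∀ s {t} → Truthy (ifT s t nil) → Truthy s × Truthy t
∧-elim nil        h = contradiction refl h
∧-elim (cons _ _) h = (λ ()) , h

∧-intro : ∀ {s t} → Truthy s → Truthy t → Truthy (ifT s t nil)
∧-intro {nil}      s≢ t≢ = contradiction refl s≢
∧-intro {cons _ _} s≢ t≢ = t≢

not-elim : ∀ t → Truthy (ifT t nil (cons nil nil)) → t ≡ nil
not-elim nil        h = refl
not-elim (cons _ _) h = contradiction refl h

not-intro : ∀ {t} → t ≡ nil → Truthy (ifT t nil (cons nil nil))
not-intro refl ()

elements : Tree → List Tree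
elements nil        = []
elements (cons h t) = h ∷ elements t

len : Tree → ℕ
len nil        = 0
len (cons h t) = suc (len t)

len-0 : ∀ t → len t ≡ 0 → t ≡ nil
len-0 nil _ = refl

elements-encodeList : ∀ {A : Set} (f : A → Tree) xs → elements (encodeList f xs) ≡ map f xs
elements-encodeList f []       = refl
elements-encodeList f (x ∷ xs) = cong (f x ∷_) (elements-encodeList f xs)

∈-encodeList⁺ : ∀ {A : Set} (f : A → Tree) {xs x} → x ∈ xs → f x ∈ elements (encodeList f xs)
∈-encodeList⁺ f {xs} x∈ = subst (_ ∈_) (sym (elements-encodeList f xs)) (∈-map⁺ f x∈)

∈-encodeList⁻ : ∀ {A : Set} (f : A → Tree) xs {t} → t ∈ elements (encodeList f xs) →
  ∃[ x ] (x ∈ xs × t ≡ f x)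
∈-encodeList⁻ f xs t∈ = ∈-map⁻ f (subst (_ ∈_) (elements-encodeList f xs) t∈)

module _ (P : Tree → Tree) where

  private
    all any : Tree → Tree → Tree
    all acc xs = ifT acc (P (head xs)) nil
    any acc xs = ifT acc (cons nil nil) (P (head xs))

  all-fold⁻ : ∀ xs acc → Truthy (foldT all xs acc) →
    Truthy acc × (∀ {x} → x ∈ elements xs → Truthy (P x))
  all-fold⁻ nil        acc h = h , λ ()
  all-fold⁻ (cons x t) acc h with all-fold⁻ t (all acc (cons x t)) h
  ... | now , later with ∧-elim acc now
  ... | acc≢ , Px = acc≢ , λ { (here refl) → Px ; (there x∈) → later x∈ }

  all-fold⁺ : ∀ xs acc → Truthy acc → (∀ {x} → x ∈ elements xs → Truthy (P x)) →
    Truthy (foldT all xs acc)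
  all-fold⁺ nil        acc acc≢ h = acc≢
  all-fold⁺ (cons x t) acc acc≢ h = all-fold⁺ t _ (∧-intro acc≢ (h (here refl))) (h ∘ there)

  any-fold⁻ : ∀ xs acc → Truthy (foldT any xs acc) →
    Truthy acc ⊎ (∃[ x ] x ∈ elements xs × Truthy (P x))
  any-fold⁻ nil        acc h = inj₁ h
  any-fold⁻ (cons x t) acc h with any-fold⁻ t (any acc (cons x t)) h
  ... | inj₂ (y , y∈ , Py) = inj₂ (y , there y∈ , Py)
  any-fold⁻ (cons x t) nil        h | inj₁ Px = inj₂ (x , here refl , Px)
  any-fold⁻ (cons x t) (cons _ _) h | inj₁ _  = inj₁ λ ()

  any-fold⁺₁ : ∀ xs acc → Truthy acc → Truthy (foldT any xs acc)
  any-fold⁺₁ nil        acc        h = h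
  any-fold⁺₁ (cons x t) nil        h = contradiction refl h
  any-fold⁺₁ (cons x t) (cons _ _) h = any-fold⁺₁ t _ λ ()

  any-fold⁺₂ : ∀ xs acc {x} → x ∈ elements xs → Truthy (P x) → Truthy (foldT any xs acc)
  any-fold⁺₂ (cons x t) nil        (here refl) Px = any-fold⁺₁ t _ Px
  any-fold⁺₂ (cons x t) (cons _ _) (here refl) Px = any-fold⁺₁ t _ λ ()
  any-fold⁺₂ (cons x t) acc        (there x∈)  Px = any-fold⁺₂ t _ x∈ Px

  private
    collect : Tree → Tree → Tree
    collect acc xs = cons (P (head xs)) acc

  collect-fold⁻ : ∀ xs acc {y} → y ∈ elements (foldT collect xs acc) →
    y ∈ elements acc ⊎ (∃[ x ] x ∈ elements xs × y ≡ P x)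
  collect-fold⁻ nil        acc y∈ = inj₁ y∈
  collect-fold⁻ (cons x t) acc y∈ with collect-fold⁻ t (collect acc (cons x t)) y∈
  ... | inj₁ (here y≡)      = inj₂ (x , here refl , y≡)
  ... | inj₁ (there y∈acc)  = inj₁ y∈acc
  ... | inj₂ (z , z∈ , y≡)  = inj₂ (z , there z∈ , y≡)

  collect-fold⁺₁ : ∀ xs acc {y} → y ∈ elements acc → y ∈ elements (foldT collect xs acc)
  collect-fold⁺₁ nil        acc y∈ = y∈
  collect-fold⁺₁ (cons x t) acc y∈ = collect-fold⁺₁ t _ (there y∈)

  collect-fold⁺₂ : ∀ xs acc {x} → x ∈ elements xs → P x ∈ elements (foldT collect xs acc)
  collect-fold⁺₂ (cons x t) acc (here refl) = collect-fold⁺₁ t _ (here refl)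
  collect-fold⁺₂ (cons x t) acc (there x∈)  = collect-fold⁺₂ t _ x∈

infix 4 _⊑_
-- Suffixes rather than elements, because the step of a fold sees the whole remaining list; the
-- tails of the suffixes of `J` are the shifts.
data _⊑_ (xs : Tree) : Tree → Set where
  here  : xs ⊑ xs
  there : ∀ {h t} → xs ⊑ t → xs ⊑ cons h t

⊑⇒∈ : ∀ {h t l} → cons h t ⊑ l → h ∈ elements l
⊑⇒∈ here      = here refl
⊑⇒∈ (there s) = there (⊑⇒∈ s)

∈⇒⊑ : ∀ l {h} → h ∈ elements l → ∃[ t ] cons h t ⊑ l
∈⇒⊑ (cons h t) (here refl) = t , here
∈⇒⊑ (cons h t) (there h∈)  with ∈⇒⊑ t h∈
... | t′ , s = t′ , there s

⊑⇒len< : ∀ {h t l} → cons h t ⊑ l → len t < len l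
⊑⇒len< here      = ≤-refl
⊑⇒len< (there s) = m≤n⇒m≤1+n (⊑⇒len< s)

-- Guarantees that a sweep over `J` tries every shift below its length.
len<⇒⊑ : ∀ l {k} → k < len l → ∃[ h ] ∃[ t ] (cons h t ⊑ l × len t ≡ k)
len<⇒⊑ (cons h t) {k} k< with k ≟ len t
... | yes refl = h , t , here , refl
... | no k≢ with len<⇒⊑ t (≤∧≢⇒< (s≤s⁻¹ k<) k≢)
...   | h′ , t′ , s , eq = h′ , t′ , there s , eq

module _ {g : Tree → Tree → Tree} (I : Tree → Set) where

  fold-invariant : ∀ l {i} → (∀ {h t acc} → cons h t ⊑ l → I acc → I (g acc (cons h t))) →
    I i → I (foldT g l i)
  fold-invariant nil        inv Ii = Ii
  fold-invariant (cons h t) inv Ii = fold-invariant t (inv ∘ there) (inv here Ii)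

  -- `I` is what survives until the fold arrives at the chosen suffix, `P` what the step there
  -- achieves and the later ones preserve. In the saturation, the premises are still present when
  -- the rule comes up, and its conclusion is never lost.
  fold-reaches : (P : Tree → Set) → (∀ {acc xs} → I acc → I (g acc xs)) →
    (∀ {acc xs} → P acc → P (g acc xs)) → ∀ {h t l} → cons h t ⊑ l →
    (∀ {acc} → I acc → P (g acc (cons h t))) → ∀ {i} → I i → P (foldT g l i)
  fold-reaches P keep mono {t = t} here hit Ii =
    fold-invariant′ t mono (hit Ii)
    where
    fold-invariant′ : ∀ l {i} → (∀ {acc xs} → P acc → P (g acc xs)) → P i → P (foldT g l i)
    fold-invariant′ nil        m Pi = Pi
    fold-invariant′ (cons _ l) m Pi = fold-invariant′ l m (m Pi)
  fold-reaches P keep mono (there s) hit Ii = fold-reaches P keep mono s hit (keep Ii)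

len-tail : ∀ t → len (tail t) ≡ len t ∸ 1
len-tail nil        = refl
len-tail (cons _ _) = refl

len-sub : ∀ s t → len (fun subᶠ (cons s t)) ≡ len s ∸ len t
len-sub s nil        = refl
len-sub s (cons _ t) = trans (len-sub (tail s) t)
  (trans (cong (_∸ len t) (len-tail s)) (∸-+-assoc (len s) 1 (len t)))

len-add : ∀ s t → len (fun addᶠ (cons s t)) ≡ len s + len t
len-add s nil        = sym (+-identityʳ (len s))
len-add s (cons _ t) = trans (len-add (cons nil s) t) (sym (+-suc (len s) (len t)))

leq⁻ : ∀ s t → Truthy (fun leqᶠ (cons s t)) → len s ≤ len t
leq⁻ s t h = m∸n≡0⇒m≤n (trans (sym (len-sub s t)) (cong len (not-elim (fun subᶠ (cons s t)) h)))

leq⁺ : ∀ s t → len s ≤ len t → Truthy (fun leqᶠ (cons s t))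
leq⁺ s t s≤t = not-intro (len-0 _ (trans (len-sub s t) (m≤n⇒m∸n≡0 s≤t)))

eq⁻ : ∀ s t → Truthy (fun eqᶠ (cons s t)) → len s ≡ len t
eq⁻ s t h with ∧-elim (fun leqᶠ (cons s t)) h
... | s≤t , t≤s = ≤-antisym (leq⁻ s t s≤t) (leq⁻ t s t≤s)

eq⁺ : ∀ s t → len s ≡ len t → Truthy (fun eqᶠ (cons s t))
eq⁺ s t s≡t = ∧-intro (leq⁺ s t (≤-reflexive s≡t)) (leq⁺ t s (≤-reflexive (sym s≡t)))

-- Sets of timed attributes as sets of pairs of numbers

Fact : Set
Fact = ℕ × ℕ

fact : Tree → Fact
fact p = len (head p) , len (tail p)

facts : Tree → List Fact
facts M = map fact (elements M)

infixl 6 _▹_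
_▹_ : Fact → ℕ → Fact
(y , i) ▹ k = y , i + k

fact-shift : ∀ p j → fact (fun shiftPointᶠ (cons p j)) ≡ fact p ▹ len j
fact-shift p j = cong (len (head p) ,_) (len-add (tail p) j)

member⁻ : ∀ p M → Truthy (fun memberᶠ (cons p M)) → fact p ∈ facts M
member⁻ p M h with any-fold⁻ (λ x → fun samePointᶠ (cons x p)) M nil h
... | inj₁ nil≢ = contradiction refl nil≢
... | inj₂ (q , q∈ , same) with ∧-elim (fun eqᶠ (cons (head q) (head p))) same
... | y≡ , t≡ = subst (_∈ facts M)
  (cong₂ _,_ (eq⁻ (head q) (head p) y≡) (eq⁻ (tail q) (tail p) t≡)) (∈-map⁺ fact q∈)

member⁺ : ∀ p M → fact p ∈ facts M → Truthy (fun memberᶠ (cons p M))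
member⁺ p M p∈ with ∈-map⁻ fact p∈
... | q , q∈ , eq = any-fold⁺₂ (λ x → fun samePointᶠ (cons x p)) M nil q∈
  (∧-intro (eq⁺ (head q) (head p) (sym (cong proj₁ eq)))
           (eq⁺ (tail q) (tail p) (sym (cong proj₂ eq))))

-- Correctness of the saturation

Fires : Tree → ℕ → (Fact → Set) → Set
Fires ψ k C = ∀ {e} → e ∈ facts (head ψ) → C (e ▹ k)

apply : Tree → Tree → Tree → Tree
apply j M xs = fun applyᶠ (cons M (cons xs j))

apply-grows : ∀ j {M xs z} → z ∈ facts M → z ∈ facts (apply j M xs)
apply-grows j {M} {xs} z∈
  -- Definitionally the test of `applyᶠ` on these arguments, so that abstracting over it selects the
  -- branch.
  with fun (allᶠ premiseᶠ (hdᶠ idᶠ) (tlᶠ idᶠ)) (cons (head (head xs)) (cons M j))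
... | nil      = z∈
... | cons _ _ with ∈-map⁻ fact z∈
...   | p , p∈ , refl =
  ∈-map⁺ fact (collect-fold⁺₁ (λ x → fun shiftPointᶠ (cons x j)) (tail (head xs)) M p∈)

apply-fires : ∀ j {M ψ t f} → Fires ψ (len j) (_∈ facts M) → f ∈ facts (tail ψ) →
  f ▹ len j ∈ facts (apply j M (cons ψ t))
apply-fires j {M} {ψ} {t} prem f∈
  with fun (allᶠ premiseᶠ (hdᶠ idᶠ) (tlᶠ idᶠ)) (cons (head ψ) (cons M j))
     | all-fold⁺ (λ e → fun premiseᶠ (cons e (cons M j))) (head ψ) (cons nil nil) (λ ())
         (λ {e} e∈ → member⁺ (fun shiftPointᶠ (cons e j)) M
           (subst (_∈ facts M) (sym (fact-shift e j)) (prem (∈-map⁺ fact e∈))))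
... | nil      | yes! = contradiction refl yes!
... | cons _ _ | _ with ∈-map⁻ fact f∈
...   | p , p∈ , refl = subst (_∈ _) (fact-shift p j)
  (∈-map⁺ fact (collect-fold⁺₂ (λ x → fun shiftPointᶠ (cons x j)) (tail ψ) M p∈))

apply-sound : (C : Fact → Set) → ∀ j {M ψ t} →
  (Fires ψ (len j) C → ∀ {f} → f ∈ facts (tail ψ) → C (f ▹ len j)) →
  (∀ {z} → z ∈ facts M → C z) → ∀ {z} → z ∈ facts (apply j M (cons ψ t)) → C z
apply-sound C j {M} {ψ} {t} closed M⊆C z∈
  with fun (allᶠ premiseᶠ (hdᶠ idᶠ) (tlᶠ idᶠ)) (cons (head ψ) (cons M j))
     | all-fold⁻ (λ e → fun premiseᶠ (cons e (cons M j))) (head ψ) (cons nil nil)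
... | nil      | _    = M⊆C z∈
... | cons _ _ | prem with ∈-map⁻ fact z∈
...   | p , p∈ , refl
  with collect-fold⁻ (λ x → fun shiftPointᶠ (cons x j)) (tail ψ) M p∈
...     | inj₁ p∈M            = M⊆C (∈-map⁺ fact p∈M)
...     | inj₂ (q , q∈ , refl) =
  subst C (sym (fact-shift q j)) (closed fires (∈-map⁺ fact q∈))
  where
  fires : Fires ψ (len j) C
  fires e∈ with ∈-map⁻ fact e∈
  ... | e , e∈ψ , refl = M⊆C (subst (_∈ facts M) (fact-shift e j)
    (member⁻ (fun shiftPointᶠ (cons e j)) M (proj₂ (prem (λ ())) e∈ψ)))

pass : Tree → Tree → Tree → Tree
pass Θ M js = fun passᶠ (cons M (cons js Θ))

pass-grows : ∀ Θ {M js z} → z ∈ facts M → z ∈ facts (pass Θ M js)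
pass-grows Θ {M} {js} {z} = fold-invariant (λ M → z ∈ facts M) Θ
  (λ {h} {t} {acc} _ → apply-grows (tail js) {acc} {cons h t})

pass-fires : ∀ Θ {M h j ψ f} → ψ ∈ elements Θ → Fires ψ (len j) (_∈ facts M) → f ∈ facts (tail ψ) →
  f ▹ len j ∈ facts (pass Θ M (cons h j))
pass-fires Θ {M} {h} {j} {ψ} {f} ψ∈ prem f∈ with ∈⇒⊑ Θ ψ∈
... | t , s = fold-reaches (λ M′ → ∀ {z} → z ∈ facts M → z ∈ facts M′) (λ M′ → f ▹ len j ∈ facts M′)
  (λ {acc} {xs} M⊆ z∈ → apply-grows j {acc} {xs} (M⊆ z∈))
  (λ {acc} {xs} → apply-grows j {acc} {xs}) s
  (λ {acc} M⊆ → apply-fires j {acc} {ψ} {t} (M⊆ ∘ prem) f∈) id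

Closed : Tree → ℕ → (Fact → Set) → Set
Closed Θ m C = ∀ {ψ k} → ψ ∈ elements Θ → k < m → Fires ψ k C → ∀ {f} → f ∈ facts (tail ψ) → C (f ▹ k)

pass-sound : (C : Fact → Set) → ∀ Θ {M h j m} → len j < m → Closed Θ m C →
  (∀ {z} → z ∈ facts M → C z) → ∀ {z} → z ∈ facts (pass Θ M (cons h j)) → C z
pass-sound C Θ {M} {h} {j} j< closed = fold-invariant (λ M → ∀ {z} → z ∈ facts M → C z) Θ
  (λ {ψ} {t} {acc} s → apply-sound C j {acc} {ψ} {t} (closed (⊑⇒∈ s) j<))

module _ (Θ J : Tree) where

  sweep : Tree → Tree
  sweep = foldT (pass Θ) J

  sweep-grows : ∀ {M z} → z ∈ facts M → z ∈ facts (sweep M)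
  sweep-grows {M} {z} = fold-invariant (λ M → z ∈ facts M) J
    (λ {h} {t} {acc} _ → pass-grows Θ {acc} {cons h t})

  sweep-fires : ∀ {M ψ k f} → ψ ∈ elements Θ → k < len J → Fires ψ k (_∈ facts M) →
    f ∈ facts (tail ψ) → f ▹ k ∈ facts (sweep M)
  sweep-fires {M} {ψ} {f = f} ψ∈ k< prem f∈ with len<⇒⊑ J k<
  ... | h , j , s , refl =
    fold-reaches (λ M′ → ∀ {z} → z ∈ facts M → z ∈ facts M′) (λ M′ → f ▹ len j ∈ facts M′)
      (λ {acc} {xs} M⊆ z∈ → pass-grows Θ {acc} {xs} (M⊆ z∈))
      (λ {acc} {xs} → pass-grows Θ {acc} {xs}) s
      (λ {acc} M⊆ → pass-fires Θ {acc} {h} {j} ψ∈ (M⊆ ∘ prem) f∈) id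

  sweep-sound : (C : Fact → Set) → ∀ {M} → Closed Θ (len J) C →
    (∀ {z} → z ∈ facts M → C z) → ∀ {z} → z ∈ facts (sweep M) → C z
  sweep-sound C {M} closed = fold-invariant (λ M → ∀ {z} → z ∈ facts M → C z) J
    (λ {h} {j} {acc} s → pass-sound C Θ {acc} {h} {j} (⊑⇒len< s) closed)

  stage : Tree → ℕ → Tree
  stage A zero    = A
  stage A (suc k) = sweep (stage A k)

  stage-sweep : ∀ A k → stage (sweep A) k ≡ sweep (stage A k)
  stage-sweep A zero    = refl
  stage-sweep A (suc k) = cong sweep (stage-sweep A k)

  saturate-stage : ∀ R A → foldT (stepT sweepᶠ (cons Θ J)) R A ≡ stage A (len R)
  saturate-stage nil        A = refl
  saturate-stage (cons h R) A = trans (saturate-stage R (sweep A)) (stage-sweep A (len R))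

  stage-grows : ∀ A {k l z} → k ≤ l → z ∈ facts (stage A k) → z ∈ facts (stage A l)
  stage-grows A {k} {l} {z} k≤l z∈ with m≤n⇒∃[o]m+o≡n k≤l
  ... | o , refl = go o
    where
    go : ∀ o → z ∈ facts (stage A (k + o))
    go zero    = subst (λ l → z ∈ facts (stage A l)) (sym (+-identityʳ k)) z∈
    go (suc o) = subst (λ l → z ∈ facts (stage A l)) (sym (+-suc k o))
      (sweep-grows {stage A (k + o)} (go o))

  stage-sound : (C : Fact → Set) → ∀ {A} → Closed Θ (len J) C →
    (∀ {z} → z ∈ facts A → C z) → ∀ k {z} → z ∈ facts (stage A k) → C z
  stage-sound C     closed A⊆C zero    = A⊆C
  stage-sound C {A} closed A⊆C (suc k) =
    sweep-sound C {stage A k} closed (stage-sound C {A} closed A⊆C k)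

-- A pigeonhole argument for increasing stages.

count : List Fact → List Fact → ℕ
count U []      = 0
count U (c ∷ cs) with c ∈? U
... | yes _ = suc (count U cs)
... | no  _ = count U cs

count≤length : ∀ U cs → count U cs ≤ length cs
count≤length U []       = z≤n
count≤length U (c ∷ cs) with c ∈? U
... | yes _ = s≤s (count≤length U cs)
... | no  _ = m≤n⇒m≤1+n (count≤length U cs)

count-grows : ∀ {U U′} → (∀ {z} → z ∈ U → z ∈ U′) → ∀ cs →
  count U cs ≤ count U′ cs × ((∀ {c} → c ∈ cs → c ∈ U′ → c ∈ U) ⊎ count U cs < count U′ cs)
count-grows U⊆U′ [] = z≤n , inj₁ λ ()
count-grows {U} {U′} U⊆U′ (c ∷ cs) with c ∈? U | c ∈? U′ | count-grows U⊆U′ cs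
... | yes c∈ | no c∉′ | _ = contradiction (U⊆U′ c∈) c∉′
... | no  c∉ | yes _  | ≤′ , _ = m≤n⇒m≤1+n ≤′ , inj₂ (s≤s ≤′)
... | yes c∈ | yes _  | ≤′ , inj₁ same = s≤s ≤′ , inj₁ λ { (here refl) _ → c∈ ; (there c′∈) → same c′∈ }
... | yes _  | yes _  | ≤′ , inj₂ <′   = s≤s ≤′ , inj₂ (s≤s <′)
... | no  _  | no c∉′ | ≤′ , inj₁ same =
  ≤′ , inj₁ λ { (here refl) c∈′ → contradiction c∈′ c∉′ ; (there c′∈) → same c′∈ }
... | no  _  | no _   | ≤′ , inj₂ <′   = ≤′ , inj₂ <′

length-cartesianProduct : ∀ (xs ys : List ℕ) →
  length (cartesianProduct xs ys) ≡ length xs * length ys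
length-cartesianProduct []       ys = refl
length-cartesianProduct (x ∷ xs) ys = trans (length-++ (map (x ,_) ys))
  (cong₂ _+_ (length-map (x ,_) ys) (length-cartesianProduct xs ys))

-- Each stage that adds an element of `cs` raises the count, which cannot exceed `length cs`.
-- Nothing is claimed about elements outside `cs`, which may go on appearing.
stabilises : (U : ℕ → List Fact) → (∀ k {z} → z ∈ U k → z ∈ U (suc k)) → ∀ cs →
  ∃[ k ] (k ≤ length cs × (∀ {c} → c ∈ cs → c ∈ U (suc k) → c ∈ U k))
stabilises U U⊆ cs with search (suc (length cs))
  where
  search : ∀ m → (∃[ k ] (k < m × (∀ {c} → c ∈ cs → c ∈ U (suc k) → c ∈ U k))) ⊎ m ≤ count (U m) cs
  search zero = inj₂ z≤n
  search (suc m) with search m | proj₂ (count-grows (U⊆ m) cs)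
  ... | inj₁ (k , k< , stable) | _           = inj₁ (k , m≤n⇒m≤1+n k< , stable)
  ... | inj₂ m≤                | inj₁ stable = inj₁ (m , ≤-refl , stable)
  ... | inj₂ m≤                | inj₂ <′     = inj₂ (≤-<-trans m≤ <′)
... | inj₁ (k , k< , stable) = k , s≤s⁻¹ k< , stable
... | inj₂ m≤ = contradiction (≤-trans m≤ (count≤length _ cs)) 1+n≰n

len-copies : ∀ n J → len (fun (copiesᶠ n) J) ≡ n * len J
len-copies zero    J = refl
len-copies (suc n) J = trans (len-add J (fun (copiesᶠ n) J)) (cong (len J +_) (len-copies n J))

module _ (n : ℕ) (A Θ J : Tree) where

  saturation : Tree
  saturation = fun (saturateᶠ n) (cons A (cons Θ J))

  saturation-sound : (C : Fact → Set) → Closed Θ (len J) C →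
    (∀ {z} → z ∈ facts A → C z) → ∀ {z} → z ∈ facts saturation → C z
  saturation-sound C closed A⊆C z∈ =
    stage-sound Θ J C {A} closed A⊆C (len (fun (copiesᶠ n) J))
      (subst (λ M → _ ∈ facts M) (saturate-stage Θ J (fun (copiesᶠ n) J) A) z∈)

  -- There are n * len J cells, so among as many stages one adds no cell.
  saturation-stable : ∃[ M ]
    (∀ {z} → z ∈ facts A → z ∈ facts M) ×
    (∀ {z} → z ∈ facts M → z ∈ facts saturation) ×
    (∀ {ψ k f} → ψ ∈ elements Θ → k < len J → Fires ψ k (_∈ facts M) → f ∈ facts (tail ψ) →
      proj₁ f < n → proj₂ f + k < len J → f ▹ k ∈ facts M)
  saturation-stable with stabilises (facts ∘ stage Θ J A) (λ k → sweep-grows Θ J {stage Θ J A k}) cells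
    where
    cells = cartesianProduct (upTo n) (upTo (len J))
  ... | k , k≤ , stable = stage Θ J A k , stage-grows Θ J A {0} {k} z≤n ,
    (λ z∈ → subst (λ M → _ ∈ facts M) (sym (saturate-stage Θ J (fun (copiesᶠ n) J) A))
      (stage-grows Θ J A {k} (≤-trans k≤ (≤-reflexive cells≡)) z∈)) ,
    -- The next stage contains the conclusion; being one of the cells, it belongs to the present
    -- stage already.
    λ {ψ} ψ∈ k< prem f∈ y< t< → stable (∈-cartesianProduct⁺ (∈-upTo⁺ y<) (∈-upTo⁺ t<))
      (sweep-fires Θ J {stage Θ J A k} {ψ} ψ∈ k< prem f∈)
    where
    cells≡ : length (cartesianProduct (upTo n) (upTo (len J))) ≡ len (fun (copiesᶠ n) J)
    cells≡ = begin
      length (cartesianProduct (upTo n) (upTo (len J))) ≡⟨ length-cartesianProduct (upTo n) _ ⟩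
      length (upTo n) * length (upTo (len J))
        ≡⟨ cong₂ _*_ (length-upTo n) (length-upTo (len J)) ⟩
      n * len J                                         ≡⟨ len-copies n J ⟨
      len (fun (copiesᶠ n) J) ∎
      where open ≡-Reasoning

-- Correctness of conversion and of the answer

num : ℕ → Tree
num zero    = nil
num (suc k) = cons nil (num k)

len-num : ∀ k → len (num k) ≡ k
len-num zero    = refl
len-num (suc k) = cong suc (len-num k)

weights : ℕ → ℕ → Tree
weights zero    w = nil
weights (suc c) w = cons (num w) (weights c (2 * w))

value-finished : ∀ V t → foldT (stepT valueStep nil) V (cons nil t) ≡ cons nil t
value-finished nil        t = refl
value-finished (cons _ V) t = value-finished V t

-- At weight `w` the unread digits still contribute `w * Bin.toℕ b`: reading one adds `w` or `2 * w`
-- and passes the rest on to weight `2 * w`. The hypothesis keeps the weights from running out.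
value-fold : ∀ c w b t → len (encodeℕᵇ b) ≤ c →
  len (tail (foldT (stepT valueStep nil) (weights c w) (cons (encodeℕᵇ b) t))) ≡
  len t + w * Bin.toℕ b
value-fold c w 0ᵇ t _ =
  trans (cong (len ∘ tail) (value-finished (weights c w) t))
    (sym (trans (cong (len t +_) (*-zeroʳ w)) (+-identityʳ (len t))))
value-fold (suc c) w 2[1+ b ] t (s≤s ≤c) = trans (value-fold c (2 * w) b _ ≤c) (begin
  len (fun addᶠ (cons t ww)) + 2 * w * Bin.toℕ b
    ≡⟨ cong (_+ 2 * w * Bin.toℕ b) (trans (len-add t ww) (cong (len t +_)
         (trans (len-add (num w) (num w)) (cong₂ _+_ (len-num w) (len-num w))))) ⟩
  len t + (w + w) + 2 * w * Bin.toℕ b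
    ≡⟨ identity (len t) w (Bin.toℕ b) ⟩
  len t + w * (2 * suc (Bin.toℕ b)) ∎)
  where
  open ≡-Reasoning
  ww = fun addᶠ (cons (num w) (num w))
  identity : ∀ l w b → l + (w + w) + 2 * w * b ≡ l + w * (2 * (1 + b))
  identity = ℕSolver.solve-∀
value-fold (suc c) w 1+[2 b ] t (s≤s ≤c) = trans (value-fold c (2 * w) b _ ≤c) (begin
  len (fun addᶠ (cons t (num w))) + 2 * w * Bin.toℕ b
    ≡⟨ cong (_+ 2 * w * Bin.toℕ b) (trans (len-add t (num w)) (cong (len t +_) (len-num w))) ⟩
  len t + w + 2 * w * Bin.toℕ b
    ≡⟨ identity (len t) w (Bin.toℕ b) ⟩
  len t + w * suc (2 * Bin.toℕ b) ∎)
  where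
  open ≡-Reasoning
  identity : ∀ l w b → l + w + 2 * w * b ≡ l + w * (1 + 2 * b)
  identity = ℕSolver.solve-∀

len-value : ∀ c b → len (encodeℕᵇ b) ≤ c →
  len (fun valueᶠ (cons (encodeℕᵇ b) (weights c 1))) ≡ Bin.toℕ b
len-value c b ≤c = trans (value-fold c 1 b nil ≤c) (*-identityˡ (Bin.toℕ b))

len-encodeAttribute : ∀ {n} (y : Fin n) → len (encodeAttribute y) ≡ toℕ y
len-encodeAttribute Fin.zero    = refl
len-encodeAttribute (Fin.suc y) = cong suc (len-encodeAttribute y)

+-cancelʳ-≤ℤ : ∀ k i j → i ℤ.+ k ℤ.≤ j ℤ.+ k → i ℤ.≤ j
+-cancelʳ-≤ℤ k i j i+k≤j+k =
  subst₂ ℤ._≤_ (cancel i k) (cancel j k) (ℤ.+-monoˡ-≤ (ℤ.- k) i+k≤j+k)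
  where
  cancel : ∀ i k → i ℤ.+ k ℤ.+ ℤ.- k ≡ i
  cancel = solve-∀

module _ {n : ℕ} where

  -- A relation, since a point earlier than -N has no code at offset `N`.
  Codes : ℕ → TimedAttribute n → Fact → Set
  Codes N (y , i) (x , t) = x ≡ toℕ y × pos t ≡ i ℤ.+ pos N

  codes-functional : ∀ {N} p {z z′} → Codes N p z → Codes N p z′ → z ≡ z′
  codes-functional _ (refl , t≡) (refl , t′≡) = cong (_ ,_) (ℤ.+-injective (trans t≡ (sym t′≡)))

  codes-injective : ∀ {N p p′ z} → Codes N p z → Codes N p′ z → p ≡ p′
  codes-injective {N} {y , i} {y′ , i′} (x≡ , t≡) (x≡′ , t≡′) =
    cong₂ _,_ (toℕ-injective (trans (sym x≡) x≡′))
      (ℤ.≤-antisym (+-cancelʳ-≤ℤ (pos N) i i′ (ℤ.≤-reflexive eq)) (+-cancelʳ-≤ℤ (pos N) i′ i (ℤ.≤-reflexive (sym eq))))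
    where eq = trans (sym t≡) t≡′

  codes-shift : ∀ {N} p {z} k → Codes N p z → Codes (N + k) p (z ▹ k)
  codes-shift {N} (y , i) {x , t} k (x≡ , t≡) = x≡ , (begin
    pos (t + k)             ≡⟨ ℤ.pos-+ t k ⟩
    pos t ℤ.+ pos k           ≡⟨ cong (ℤ._+ pos k) t≡ ⟩
    i ℤ.+ pos N ℤ.+ pos k     ≡⟨ ℤ.+-assoc i (pos N) (pos k) ⟩
    i ℤ.+ (pos N ℤ.+ pos k)   ≡⟨ cong (ℤ._+_ i) (ℤ.pos-+ N k) ⟨
    i ℤ.+ pos (N + k)       ∎)
    where open ≡-Reasoning

  -- Growing the offset by m lets the natural shift k stand for the integer shift k − m.
  codes-▹ : ∀ {N} p {z} m k → Codes N p z → Codes (N + m) (p ≫ (pos k ℤ.- pos m)) (z ▹ k)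
  codes-▹ {N} (y , i) {x , t} m k (x≡ , t≡) = x≡ , (begin
    pos (t + k)                                ≡⟨ ℤ.pos-+ t k ⟩
    pos t ℤ.+ pos k                              ≡⟨ cong (ℤ._+ pos k) t≡ ⟩
    i ℤ.+ pos N ℤ.+ pos k                        ≡⟨ identity i (pos N) (pos k) (pos m) ⟩
    i ℤ.+ (pos k ℤ.- pos m) ℤ.+ (pos N ℤ.+ pos m)    ≡⟨ cong (ℤ._+_ (i ℤ.+ (pos k ℤ.- pos m))) (ℤ.pos-+ N m) ⟨
    i ℤ.+ (pos k ℤ.- pos m) ℤ.+ pos (N + m)        ∎)
    where
    open ≡-Reasoning
    identity : ∀ i N k m → i ℤ.+ N ℤ.+ k ≡ i ℤ.+ (k ℤ.- m) ℤ.+ (N ℤ.+ m)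
    identity = solve-∀

  record Represents (N : ℕ) (A : FiniteSubset n) (M : Tree) : Set where
    field
      decode : ∀ {z} → z ∈ facts M → ∃[ p ] (p ∈ A × Codes N p z)
      encode : ∀ {p} → p ∈ A → ∃[ z ] (z ∈ facts M × Codes N p z)

  open Represents

  represents-shift : ∀ {N A M} j → Represents N A M →
    Represents (N + len j) A (fun shiftSetᶠ (cons M j))
  represents-shift {N} {A} {M} j rep .decode z∈ with ∈-map⁻ fact z∈
  ... | q , q∈ , refl with collect-fold⁻ (λ x → fun shiftPointᶠ (cons x j)) M nil q∈
  ...   | inj₂ (x , x∈ , refl) with rep .decode (∈-map⁺ fact x∈)
  ...     | p , p∈ , codes = p , p∈ ,
    subst (Codes _ p) (sym (fact-shift x j)) (codes-shift p (len j) codes)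
  represents-shift {N} {A} {M} j rep .encode {p} p∈ with rep .encode p∈
  ... | z , z∈ , codes with ∈-map⁻ fact z∈
  ...   | x , x∈ , refl = _ ,
    ∈-map⁺ fact (collect-fold⁺₂ (λ x → fun shiftPointᶠ (cons x j)) M nil x∈) ,
    subst (Codes _ p) (sym (fact-shift x j)) (codes-shift p (len j) codes)

  RepresentsFormula : ℕ → Formula n → Tree → Set
  RepresentsFormula N φ ψ =
    Represents N (antecedent φ) (head ψ) × Represents N (consequent φ) (tail ψ)

  record RepresentsTheory (N : ℕ) (T : FiniteTheory n) (Θ : Tree) : Set where
    field
      decode : ∀ {ψ} → ψ ∈ elements Θ → ∃[ φ ] (φ ∈ T × RepresentsFormula N φ ψ)
      encode : ∀ {φ} → φ ∈ T → ∃[ ψ ] (ψ ∈ elements Θ × RepresentsFormula N φ ψ)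

  module Theory = RepresentsTheory

  module _ (c : ℕ) (K : Tree) where

    private
      ρ = cons (weights c 1) K

    InRange : TimedAttribute n → Set
    InRange (y , i) = ∣ i ∣ ≤ len K × len (encodeℕᵇ (fromℕ ∣ i ∣)) ≤ c

    FormulaInRange : Formula n → Set
    FormulaInRange (A ⇒ B) = (∀ {p} → p ∈ A → InRange p) × (∀ {p} → p ∈ B → InRange p)

    codes-conv : ∀ p → InRange p →
      Codes (len K) p (fact (fun convPointᶠ (cons (encodeTimedAttribute p) ρ)))
    codes-conv (y , pos k) (_ , ≤c) = len-encodeAttribute y , cong pos (begin
      len (fun addᶠ (cons K v)) ≡⟨ len-add K v ⟩
      len K + len v
        ≡⟨ cong (len K +_) (trans (len-value c (fromℕ k) ≤c) (toℕ-fromℕ k)) ⟩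
      len K + k                 ≡⟨ +-comm (len K) k ⟩
      k + len K                 ∎)
      where
      open ≡-Reasoning
      v = fun valueᶠ (cons (encodeℕᵇ (fromℕ k)) (weights c 1))
    -- The range hypothesis makes the truncated subtraction exact.
    codes-conv (y , -[1+ k ]) (≤K , ≤c) = len-encodeAttribute y , (begin
      pos (len (fun subᶠ (cons K v))) ≡⟨ cong pos (len-sub K v) ⟩
      pos (len K ∸ len v)
        ≡⟨ cong (λ k → pos (len K ∸ k)) (trans (len-value c (fromℕ (suc k)) ≤c) (toℕ-fromℕ (suc k))) ⟩
      pos (len K ∸ suc k)           ≡⟨ ℤ.⊖-≥ ≤K ⟨
      len K ℤ.⊖ suc k             ∎)
      where
      open ≡-Reasoning
      v = fun valueᶠ (cons (encodeℕᵇ (fromℕ (suc k))) (weights c 1))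

    represents-conv : ∀ A → (∀ {p} → p ∈ A → InRange p) →
      Represents (len K) A (fun convSetᶠ (cons (encodeList encodeTimedAttribute A) ρ))
    represents-conv A range .decode z∈ with ∈-map⁻ fact z∈
    ... | q , q∈ , refl
      with collect-fold⁻ (λ x → fun convPointᶠ (cons x ρ)) (encodeList encodeTimedAttribute A) nil q∈
    ...   | inj₂ (x , x∈ , refl)
      with ∈-encodeList⁻ encodeTimedAttribute A x∈
    ...     | p , p∈ , refl = p , p∈ , codes-conv p (range p∈)
    represents-conv A range .encode {p} p∈ = _ ,
      ∈-map⁺ fact (collect-fold⁺₂ (λ x → fun convPointᶠ (cons x ρ)) (encodeList encodeTimedAttribute A) nil
        (∈-encodeList⁺ encodeTimedAttribute p∈)) ,
      codes-conv p (range p∈)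

    represents-convFormula : ∀ φ → FormulaInRange φ →
      RepresentsFormula (len K) φ (fun convFormulaᶠ (cons (encodeFormula φ) ρ))
    represents-convFormula (A ⇒ B) (rangeA , rangeB) =
      represents-conv A rangeA , represents-conv B rangeB

    represents-convTheory : ∀ T → (∀ {φ} → φ ∈ T → FormulaInRange φ) →
      RepresentsTheory (len K) T
        (fun (collectᶠ convFormulaᶠ (hdᶠ idᶠ) nilᶠ (tlᶠ idᶠ)) (cons (encodeList encodeFormula T) ρ))
    represents-convTheory T range .Theory.decode ψ∈
      with collect-fold⁻ (λ x → fun convFormulaᶠ (cons x ρ)) (encodeList encodeFormula T) nil ψ∈
    ... | inj₂ (x , x∈ , refl)
      with ∈-encodeList⁻ encodeFormula T x∈
    ...   | φ , φ∈ , refl = φ , φ∈ , represents-convFormula φ (range φ∈)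
    represents-convTheory T range .Theory.encode {φ} φ∈ = _ ,
      collect-fold⁺₂ (λ x → fun convFormulaᶠ (cons x ρ)) (encodeList encodeFormula T) nil
        (∈-encodeList⁺ encodeFormula φ∈) ,
      represents-convFormula φ (range φ∈)

  represents-nonempty⁻ : ∀ {N A M} → Represents N A M → Truthy M → A ≢ []
  represents-nonempty⁻ {M = nil}      rep M≢ refl = M≢ refl
  represents-nonempty⁻ {M = cons _ _} rep M≢ refl with rep .decode (here refl)
  ... | _ , () , _

  represents-nonempty⁺ : ∀ {N A M} → Represents N A M → A ≢ [] → Truthy M
  represents-nonempty⁺ {A = []}    rep A≢ refl = A≢ refl
  represents-nonempty⁺ {A = p ∷ A} rep A≢ refl with rep .encode (here refl)
  ... | _ , () , _

  private
    later : Tree → Tree → Tree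
    later a b = fun leqᶠ (cons (tail a) (tail b))

  predictive⁻ : ∀ {N φ} ψ → RepresentsFormula N φ ψ → Truthy (fun predictiveᶠ ψ) → Predictive φ
  predictive⁻ {N} {A ⇒ B} ψ (repA , repB) h with ∧-elim (head ψ) h
  ... | ψ₁ , h′ with ∧-elim (tail ψ) h′
  ... | ψ₂ , h″ = represents-nonempty⁻ repA ψ₁ , represents-nonempty⁻ repB ψ₂ , ordered
    where
    ordered : ∀ {x i y j} → (x , i) ∈ A → (y , j) ∈ B → i ℤ.≤ j
    ordered {x} {i} {y} {j} p∈ q∈ with repA .encode p∈ | repB .encode q∈
    ... | z , z∈ , _ , i≡ | w , w∈ , _ , j≡ with ∈-map⁻ fact z∈ | ∈-map⁻ fact w∈
    ...   | a , a∈ , refl | b , b∈ , refl =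
      +-cancelʳ-≤ℤ (pos N) i j (subst₂ ℤ._≤_ i≡ j≡ (+≤+ (leq⁻ (tail a) (tail b)
        (proj₂ (all-fold⁻ (later a) (tail ψ) (cons nil nil)
          (proj₂ (all-fold⁻ (λ a → foldT _ (tail ψ) (cons nil nil)) (head ψ) (cons nil nil) h″) a∈)) b∈))))

  predictive⁺ : ∀ {N φ} ψ → RepresentsFormula N φ ψ → Predictive φ → Truthy (fun predictiveᶠ ψ)
  predictive⁺ {N} {A ⇒ B} ψ (repA , repB) (A≢ , B≢ , A≤B) =
    ∧-intro (represents-nonempty⁺ repA A≢) (∧-intro (represents-nonempty⁺ repB B≢)
      (all-fold⁺ (λ a → foldT _ (tail ψ) (cons nil nil)) (head ψ) (cons nil nil) (λ ())
        λ {a} a∈ → all-fold⁺ (later a) (tail ψ) (cons nil nil) (λ ())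
          λ {b} b∈ → leq⁺ (tail a) (tail b) (ordered a∈ b∈)))
    where
    ordered : ∀ {a b} → a ∈ elements (head ψ) → b ∈ elements (tail ψ) →
      len (tail a) ≤ len (tail b)
    ordered a∈ b∈ with repA .decode (∈-map⁺ fact a∈) | repB .decode (∈-map⁺ fact b∈)
    ... | (x , i) , p∈ , _ , i≡ | (y , j) , q∈ , _ , j≡ =
      ℤ.drop‿+≤+ (subst₂ ℤ._≤_ (sym i≡) (sym j≡) (ℤ.+-monoˡ-≤ (pos N) (A≤B p∈ q∈)))

  codes-exist : ∀ {N} p → ℤ.- pos N ℤ.≤ proj₂ p → ∃[ z ] Codes N p z
  codes-exist {N} (y , i) -N≤i = (toℕ y , ∣ i ℤ.+ pos N ∣) , refl ,
    ℤ.0≤i⇒+∣i∣≡i (subst (ℤ._≤ i ℤ.+ pos N) (ℤ.+-inverseˡ (pos N)) (ℤ.+-monoˡ-≤ (pos N) -N≤i))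

  -- Having codes at offset `K` already bounds the points of rules below by -K. With antecedents at
  -- most `K` and `A` at least -K, the shifts needed for conclusions up to `K` lie between -2K and
  -- 2K; `B≤` ensures that only such conclusions are asked for.
  module Correctness {T : FiniteTheory n} {A B : FiniteSubset n} {K : ℕ} {Θ φ′ J : Tree}
    (repT : RepresentsTheory K T Θ)
    (repφ : RepresentsFormula (K + (K + K)) (A ⇒ B) φ′)
    (len-J : len J ≡ suc (K + (K + (K + K))))
    (T≤ : ∀ {φ} → φ ∈ T → ∀ {p} → p ∈ antecedent φ → proj₂ p ℤ.≤ pos K)
    (A≥ : ∀ {p} → p ∈ A → ℤ.- pos K ℤ.≤ proj₂ p)
    (B≤ : ∀ {p} → p ∈ B → proj₂ p ℤ.≤ pos K)
    where

    private
      sat = saturation n (head φ′) Θ J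

      InClosure : Fact → Set
      InClosure z = ∃[ p ] (Closure T A p × Codes (K + (K + K)) p z)

    closed : Closed Θ (len J) InClosure
    closed {k = k} ψ∈ k< fires f∈ with repT .Theory.decode ψ∈
    ... | φ , φ∈ , repE , repF with repF .decode f∈
    ...   | q , q∈ , codes =
      -- The natural shift `k` stands for `k - 2K`: the difference of 2K is the one between the
      -- offset of the rules and that of the facts.
      _ , step φ∈ (pos k ℤ.- pos (K + K)) premise q∈ , codes-▹ q (K + K) k codes
      where
      premise : ∀ {p} → p ∈ antecedent φ → Closure T A (p ≫ (pos k ℤ.- pos (K + K)))
      premise {p} p∈ with repE .encode p∈
      ... | e , e∈ , codes′ with fires e∈
      ...   | p′ , p′∈ , codes″ =
        subst (Closure T A) (codes-injective codes″ (codes-▹ p (K + K) k codes′)) p′∈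

    sat-sound : ∀ {z} → z ∈ facts sat → InClosure z
    sat-sound = saturation-sound n (head φ′) Θ J InClosure closed
      λ z∈ → let p , p∈ , codes = repφ .proj₁ .decode z∈ in p , base p∈ , codes

    code-bound : ∀ p {z} → proj₂ p ℤ.≤ pos K → Codes (K + (K + K)) p z → proj₂ z < len J
    code-bound p {x , t} p≤ (_ , t≡) = subst (t <_) (sym len-J) (s≤s (ℤ.drop‿+≤+
      (subst₂ ℤ._≤_ (sym t≡) (sym (ℤ.pos-+ K (K + (K + K)))) (ℤ.+-monoˡ-≤ (pos (K + (K + K))) p≤))))

    -- With time t of the code of i and u of the code of i + j, the shift is k = u − t.
    shift-natural : ∀ i j {t} → i ℤ.≤ pos K → pos t ≡ i ℤ.+ pos K →
      ℤ.- pos K ℤ.≤ i ℤ.+ j → i ℤ.+ j ℤ.≤ pos K →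
      ∃[ k ] (k < len J × j ≡ pos k ℤ.- pos (K + K))
    shift-natural i j {t} i≤ t≡ ≥-K ≤K =
      u ∸ t ,
      subst (u ∸ t <_) (sym len-J) (s≤s (≤-trans (m∸n≤m u t) (ℤ.drop‿+≤+ (begin
        pos u                             ≡⟨ u≡ ⟩
        i ℤ.+ j ℤ.+ pos (K + (K + K))     ≤⟨ ℤ.+-monoˡ-≤ (pos (K + (K + K))) ≤K ⟩
        pos K ℤ.+ pos (K + (K + K))       ≡⟨ ℤ.pos-+ K (K + (K + K)) ⟨
        pos (K + (K + (K + K)))           ∎)))) ,
      (begin-equality
        j
          ≡⟨ identity i j (pos K) ⟩
        i ℤ.+ j ℤ.+ (pos K ℤ.+ (pos K ℤ.+ pos K)) ℤ.- (i ℤ.+ pos K) ℤ.- (pos K ℤ.+ pos K)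
          ≡⟨ cong₂ (λ a b → i ℤ.+ j ℤ.+ a ℤ.- (i ℤ.+ pos K) ℤ.- b) 3K≡ (ℤ.pos-+ K K) ⟨
        i ℤ.+ j ℤ.+ pos (K + (K + K)) ℤ.- (i ℤ.+ pos K) ℤ.- pos (K + K)
          ≡⟨ cong₂ (λ a b → a ℤ.- b ℤ.- pos (K + K)) u≡ t≡ ⟨
        pos u ℤ.- pos t ℤ.- pos (K + K)
          ≡⟨ cong (ℤ._- pos (K + K)) (trans (ℤ.m-n≡m⊖n u t) (ℤ.⊖-≥ t≤u)) ⟩
        pos (u ∸ t) ℤ.- pos (K + K) ∎)
      where
      open ℤ.≤-Reasoning
      u = ∣ i ℤ.+ j ℤ.+ pos (K + (K + K)) ∣
      3K≡ : pos (K + (K + K)) ≡ pos K ℤ.+ (pos K ℤ.+ pos K)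
      3K≡ = trans (ℤ.pos-+ K (K + K)) (cong (ℤ._+_ (pos K)) (ℤ.pos-+ K K))
      identity : ∀ i j K → j ≡ i ℤ.+ j ℤ.+ (K ℤ.+ (K ℤ.+ K)) ℤ.- (i ℤ.+ K) ℤ.- (K ℤ.+ K)
      identity = solve-∀
      2K≤ : pos (K + K) ℤ.≤ i ℤ.+ j ℤ.+ pos (K + (K + K))
      2K≤ = begin
        pos (K + K)                          ≡⟨ ℤ.pos-+ K K ⟩
        pos K ℤ.+ pos K                      ≡⟨ cancel (pos K) ⟩
        ℤ.- pos K ℤ.+ (pos K ℤ.+ (pos K ℤ.+ pos K)) ≡⟨ cong (ℤ._+_ (ℤ.- pos K)) 3K≡ ⟨
        ℤ.- pos K ℤ.+ pos (K + (K + K))      ≤⟨ ℤ.+-monoˡ-≤ (pos (K + (K + K))) ≥-K ⟩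
        i ℤ.+ j ℤ.+ pos (K + (K + K))        ∎
        where
        cancel : ∀ K → K ℤ.+ K ≡ ℤ.- K ℤ.+ (K ℤ.+ (K ℤ.+ K))
        cancel = solve-∀
      u≡ : pos u ≡ i ℤ.+ j ℤ.+ pos (K + (K + K))
      u≡ = ℤ.0≤i⇒+∣i∣≡i (ℤ.≤-trans (+≤+ z≤n) 2K≤)
      t≤u : t ≤ u
      t≤u = ℤ.drop‿+≤+ (begin
        pos t            ≡⟨ t≡ ⟩
        i ℤ.+ pos K      ≤⟨ ℤ.+-monoˡ-≤ (pos K) i≤ ⟩
        pos K ℤ.+ pos K  ≡⟨ ℤ.pos-+ K K ⟨
        pos (K + K)      ≤⟨ 2K≤ ⟩
        i ℤ.+ j ℤ.+ pos (K + (K + K)) ≡⟨ u≡ ⟨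
        pos u            ∎)

    module _ (pred : All Predictive T) where

      -- Premises are no later than their conclusion, so the bound `K` is inherited along the
      -- derivation. The induction takes place inside one stable stage `M`, where all premises of a
      -- step are found together and the conclusion, being a cell, is present too.
      sat-complete : ∀ {p z} → Closure T A p → proj₂ p ℤ.≤ pos K → Codes (K + (K + K)) p z →
        z ∈ facts sat
      sat-complete with saturation-stable n (head φ′) Θ J
      ... | M , A⊆M , M⊆sat , stable = λ p∈ p≤ codes → M⊆sat (go p∈ p≤ codes)
        where
        go : ∀ {p z} → Closure T A p → proj₂ p ℤ.≤ pos K → Codes (K + (K + K)) p z → z ∈ facts M
        go (base {p} p∈A) p≤ codes with repφ .proj₁ .encode p∈A
        ... | z′ , z′∈ , codes′ = subst (_∈ facts M) (codes-functional p codes′ codes) (A⊆M z′∈)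
        go (step {φ} φ∈ j E≤ {q} q∈) q≤ codes with All.lookup pred φ∈ | repT .Theory.encode φ∈
        go (step {[] ⇒ F} φ∈ j E≤ {q} q∈) q≤ codes | E≢[] , _ | _ = contradiction refl E≢[]
        go (step {E@((x , i) ∷ _) ⇒ F} φ∈ j E≤ {q} q∈) q≤ codes | _ , _ , E≤F | ψ , ψ∈ , repE , repF
          with repE .encode (here refl) | repF .encode q∈
        ... | e , _ , _ , t≡ | f , f∈ , codesF
          -- A single premise suffices to confine `j`: its shifted time is at least -K, as it lies
          -- in the closure, and at most `K`, as it does not exceed that of the conclusion.
          with shift-natural i j (T≤ φ∈ (here refl)) t≡
                 (closure-≥ pred A≥ (E≤ (here refl)))
                 (ℤ.≤-trans (ℤ.+-monoˡ-≤ j (E≤F (here refl) q∈)) q≤)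
        ... | k , k< , refl = subst (_∈ facts M) (codes-functional (q ≫ (pos k ℤ.- pos (K + K))) codesF′ codes)
          (stable {ψ} {k} ψ∈ k< fires f∈
            (subst (_< n) (sym (proj₁ codesF)) (toℕ<n (proj₁ q)))
            (code-bound (q ≫ (pos k ℤ.- pos (K + K))) q≤ codesF′))
          where
          codesF′ = codes-▹ q (K + K) k codesF
          fires : Fires ψ k (_∈ facts M)
          fires e∈ with repE .decode e∈
          ... | p , p∈ , codesE =
            go (E≤ p∈) (ℤ.≤-trans (ℤ.+-monoˡ-≤ j (E≤F p∈ q∈)) q≤) (codes-▹ p (K + K) k codesE)

    answer⁻ : Truthy (fun (answerᶠ n) (cons φ′ (cons Θ J))) →
      Predictive (A ⇒ B) × All Predictive T × (∀ {p} → p ∈ B → Closure T A p)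
    answer⁻ h with ∧-elim (fun predictiveᶠ φ′) h
    ... | h₁ , h′ with ∧-elim (fun (allᶠ (predictiveᶠ ∘ᶠ hdᶠ idᶠ) idᶠ nilᶠ) Θ) h′
    ... | h₂ , h₃ = predictive⁻ φ′ repφ h₁ , All.tabulate rule , derivable
      where
      rule : ∀ {φ} → φ ∈ T → Predictive φ
      rule φ∈ with repT .Theory.encode φ∈
      ... | ψ , ψ∈ , rep = predictive⁻ ψ rep
        (proj₂ (all-fold⁻ (fun predictiveᶠ) Θ (cons nil nil) h₂) ψ∈)
      derivable : ∀ {p} → p ∈ B → Closure T A p
      derivable p∈ with repφ .proj₂ .encode p∈
      ... | z , z∈ , codes with ∈-map⁻ fact z∈
      ...   | b , b∈ , refl
        with sat-sound (member⁻ b sat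
               (proj₂ (all-fold⁻ (λ b → fun memberᶠ (cons b sat)) (tail φ′) (cons nil nil) h₃) b∈))
      ...     | p′ , p′∈ , codes′ = subst (Closure T A) (codes-injective codes′ codes) p′∈

    answer⁺ : Predictive (A ⇒ B) → All Predictive T → (∀ {p} → p ∈ B → Closure T A p) →
      Truthy (fun (answerᶠ n) (cons φ′ (cons Θ J)))
    answer⁺ predφ predT derivable =
      ∧-intro (predictive⁺ φ′ repφ predφ) (∧-intro
        (all-fold⁺ (fun predictiveᶠ) Θ (cons nil nil) (λ ()) rule)
        (all-fold⁺ (λ b → fun memberᶠ (cons b sat)) (tail φ′) (cons nil nil) (λ ())
          λ {b} b∈ → member⁺ b sat (found b∈)))
      where
      rule : ∀ {ψ} → ψ ∈ elements Θ → Truthy (fun predictiveᶠ ψ)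
      rule {ψ} ψ∈ with repT .Theory.decode ψ∈
      ... | φ , φ∈ , rep = predictive⁺ ψ rep (All.lookup predT φ∈)
      found : ∀ {b} → b ∈ elements (tail φ′) → fact b ∈ facts sat
      found b∈ with repφ .proj₂ .decode (∈-map⁺ fact b∈)
      ... | p , p∈ , codes = sat-complete predT (derivable p∈) (B≤ p∈) codes

-- Encodings are injective

cons-injective : ∀ {s t s′ t′ : Tree} → Tree.cons s t ≡ cons s′ t′ → s ≡ s′ × t ≡ t′
cons-injective refl = refl , refl

Inj : {A : Set} → (A → Tree) → Set
Inj f = ∀ x y → f x ≡ f y → x ≡ y

encodeList-injective : ∀ {A : Set} {f : A → Tree} → Inj f → Inj (encodeList f)
encodeList-injective f-inj []       []       _  = refl
encodeList-injective f-inj (x ∷ xs) (y ∷ ys) eq with cons-injective eq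
... | x≡y , xs≡ys = cong₂ _∷_ (f-inj x y x≡y) (encodeList-injective f-inj xs ys xs≡ys)

encodeAttribute-injective : ∀ {n} → Inj (encodeAttribute {n})
encodeAttribute-injective 0F       0F       _  = refl
encodeAttribute-injective (sucF x) (sucF y) eq =
  cong sucF (encodeAttribute-injective x y (proj₂ (cons-injective eq)))

encodeℕᵇ-injective : Inj encodeℕᵇ
encodeℕᵇ-injective 0ᵇ       0ᵇ       _  = refl
encodeℕᵇ-injective 2[1+ a ] 2[1+ b ] eq = cong 2[1+_] (encodeℕᵇ-injective a b (proj₂ (cons-injective eq)))
encodeℕᵇ-injective 1+[2 a ] 1+[2 b ] eq = cong 1+[2_] (encodeℕᵇ-injective a b (proj₂ (cons-injective eq)))

encodeSign-injective : Inj encodeSign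
encodeSign-injective Sign.+ Sign.+ _ = refl
encodeSign-injective Sign.- Sign.- _ = refl

encodeℤ-injective : Inj encodeℤ
encodeℤ-injective i j eq with cons-injective eq
... | sign≡ , abs≡ = begin
  i                            ≡⟨ ℤ.◃-inverse i ⟨
  ℤ.sign i ℤ.◃ ∣ i ∣
    ≡⟨ cong₂ ℤ._◃_ (encodeSign-injective (ℤ.sign i) (ℤ.sign j) sign≡) ∣i∣≡∣j∣ ⟩
  ℤ.sign j ℤ.◃ ∣ j ∣           ≡⟨ ℤ.◃-inverse j ⟩
  j                            ∎
  where
  open ≡-Reasoning
  ∣i∣≡∣j∣ : ∣ i ∣ ≡ ∣ j ∣
  ∣i∣≡∣j∣ = begin
    ∣ i ∣                   ≡⟨ toℕ-fromℕ ∣ i ∣ ⟨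
    Bin.toℕ (fromℕ ∣ i ∣)   ≡⟨ cong Bin.toℕ (encodeℕᵇ-injective (fromℕ ∣ i ∣) (fromℕ ∣ j ∣) abs≡) ⟩
    Bin.toℕ (fromℕ ∣ j ∣)   ≡⟨ toℕ-fromℕ ∣ j ∣ ⟩
    ∣ j ∣                   ∎

module _ {n : ℕ} where

  encodeTimedAttribute-injective : Inj (encodeTimedAttribute {n})
  encodeTimedAttribute-injective (x , i) (y , j) eq with cons-injective eq
  ... | x≡y , i≡j = cong₂ _,_ (encodeAttribute-injective x y x≡y) (encodeℤ-injective i j i≡j)

  encodeFormula-injective : Inj (encodeFormula {n})
  encodeFormula-injective (A ⇒ B) (C ⇒ D) eq with cons-injective eq
  ... | A≡C , B≡D = cong₂ _⇒_
    (encodeList-injective encodeTimedAttribute-injective A C A≡C)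
    (encodeList-injective encodeTimedAttribute-injective B D B≡D)

  -- Membership in the intersection provides two instances with the same code, one for each
  -- language; injectivity identifies them with the instance that was decoded.
  encodeInstance-injective : Inj (encodeInstance {n})
  encodeInstance-injective (T , φ) (U , ψ) eq with cons-injective eq
  ... | T≡U , φ≡ψ = cong₂ _,_ (encodeList-injective encodeFormula-injective T U T≡U)
    (encodeFormula-injective φ ψ φ≡ψ)

-- Recognising encodings

Recognises : {A : Set} → Fn → (A → Tree) → Set
Recognises p f = (∀ t → Truthy (fun p t) → ∃[ x ] f x ≡ t) × (∀ x → Truthy (fun p (f x)))

RecognisesList : {A : Set} → Fn → (A → Tree) → Fn → Fn → Tree → Set
RecognisesList p f l r d =
  (Truthy (fun (allᶠ (p ∘ᶠ hdᶠ idᶠ) l r) d) → ∃[ xs ] encodeList f xs ≡ fun l d) ×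
  (∀ xs → encodeList f xs ≡ fun l d → Truthy (fun (allᶠ (p ∘ᶠ hdᶠ idᶠ) l r) d))

recognises-list : ∀ {A : Set} {p} {f : A → Tree} → Recognises p f → ∀ l r d →
  RecognisesList p f l r d
recognises-list {p = p} {f} (p⁻ , p⁺) l r d =
  (λ h → list (fun l d) (proj₂ (all-fold⁻ (fun p) (fun l d) (cons nil nil) h))) ,
  λ xs eq → all-fold⁺ (fun p) (fun l d) (cons nil nil) (λ ()) λ {t} t∈ →
    element xs (subst (λ l → t ∈ elements l) (sym eq) t∈)
  where
  list : ∀ t → (∀ {x} → x ∈ elements t → Truthy (fun p x)) → ∃[ xs ] encodeList f xs ≡ t
  list nil        h = [] , refl
  list (cons s t) h with p⁻ s (h (here refl)) | list t (h ∘ there)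
  ... | x , refl | xs , refl = x ∷ xs , refl
  element : ∀ xs {t} → t ∈ elements (encodeList f xs) → Truthy (fun p t)
  element xs t∈ with ∈-encodeList⁻ f xs t∈
  ... | x , _ , refl = p⁺ x

recognises-bool : Recognises isBoolᶠ encodeBool
recognises-bool = bool⁻ , λ { false → λ () ; true → λ () }
  where
  bool⁻ : ∀ t → Truthy (fun isBoolᶠ t) → ∃[ b ] encodeBool b ≡ t
  bool⁻ nil                   h = false , refl
  bool⁻ (cons nil nil)        h = true , refl
  bool⁻ (cons nil (cons _ _)) h = contradiction refl h
  bool⁻ (cons (cons _ _) _)   h = contradiction refl h

-- Turns numerals into lists, so that the recogniser of lists applies to them.
digits : ℕᵇ → List Bool
digits 0ᵇ       = []
digits 2[1+ b ] = true ∷ digits b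
digits 1+[2 b ] = false ∷ digits b

fromDigits : List Bool → ℕᵇ
fromDigits []          = 0ᵇ
fromDigits (true  ∷ ds) = 2[1+ fromDigits ds ]
fromDigits (false ∷ ds) = 1+[2 fromDigits ds ]

encode-digits : ∀ b → encodeList encodeBool (digits b) ≡ encodeℕᵇ b
encode-digits 0ᵇ       = refl
encode-digits 2[1+ b ] = cong (cons _) (encode-digits b)
encode-digits 1+[2 b ] = cong (cons _) (encode-digits b)

encode-fromDigits : ∀ ds → encodeℕᵇ (fromDigits ds) ≡ encodeList encodeBool ds
encode-fromDigits []           = refl
encode-fromDigits (true  ∷ ds) = cong (cons _) (encode-fromDigits ds)
encode-fromDigits (false ∷ ds) = cong (cons _) (encode-fromDigits ds)

encodeℕᵇ-fromℕ-toℕ : ∀ b {k} → Bin.toℕ b ≡ k → encodeℕᵇ (fromℕ k) ≡ encodeℕᵇ b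
encodeℕᵇ-fromℕ-toℕ b refl = cong encodeℕᵇ (fromℕ-toℕ b)

recognises-integer : Recognises isIntegerᶠ encodeℤ
recognises-integer = integer⁻ , integer⁺
  where
  bits : ∀ t → RecognisesList isBoolᶠ encodeBool (tlᶠ idᶠ) nilᶠ t
  bits = recognises-list {p = isBoolᶠ} recognises-bool (tlᶠ idᶠ) nilᶠ
  build : ∀ v b → Truthy (ifT (encodeBool v) (encodeℕᵇ b) (cons nil nil)) →
    ∃[ i ] encodeℤ i ≡ cons (encodeBool v) (encodeℕᵇ b)
  build false b h = pos (Bin.toℕ b) , cong (cons nil) (encodeℕᵇ-fromℕ-toℕ b refl)
  build true  b h with Bin.toℕ b in eq
  build true b@(2[1+ _ ]) h | suc k = -[1+ k ] , cong (cons _) (encodeℕᵇ-fromℕ-toℕ b eq)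
  build true b@(1+[2 _ ]) h | suc k = -[1+ k ] , cong (cons _) (encodeℕᵇ-fromℕ-toℕ b eq)
  build true 0ᵇ           h | _     = contradiction refl h
  integer⁻ : ∀ t → Truthy (fun isIntegerᶠ t) → ∃[ i ] encodeℤ i ≡ t
  integer⁻ nil        h = contradiction refl h
  integer⁻ (cons s t) h with ∧-elim (fun isBoolᶠ s) h
  ... | h₁ , h′ with ∧-elim (fun (allᶠ (isBoolᶠ ∘ᶠ hdᶠ idᶠ) (tlᶠ idᶠ) nilᶠ) (cons s t)) h′
  ... | h₂ , h₃ with proj₁ recognises-bool s h₁ | proj₁ (bits (cons s t)) h₂
  ... | v , refl | ds , refl with encodeList encodeBool ds | encode-fromDigits ds
  ... | _ | refl = build v (fromDigits ds) h₃
  bits⁺ : ∀ s b → Truthy (fun (allᶠ (isBoolᶠ ∘ᶠ hdᶠ idᶠ) (tlᶠ idᶠ) nilᶠ) (cons s (encodeℕᵇ b)))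
  bits⁺ s b = proj₂ (bits (cons s (encodeℕᵇ b))) (digits b) (encode-digits b)
  nonzero : ∀ b → Bin.toℕ b ≢ 0 → Truthy (encodeℕᵇ b)
  nonzero 0ᵇ b≢0 _ = b≢0 refl
  nonzero 2[1+ b ] b≢0 ()
  nonzero 1+[2 b ] b≢0 ()
  integer⁺ : ∀ i → Truthy (fun isIntegerᶠ (encodeℤ i))
  integer⁺ (pos k)  = ∧-intro {cons nil nil} (λ ()) (∧-intro (bits⁺ nil (fromℕ k)) λ ())
  integer⁺ -[1+ k ] = ∧-intro {cons nil nil} (λ ()) (∧-intro (bits⁺ (cons nil nil) (fromℕ (suc k)))
    (nonzero (fromℕ (suc k)) λ eq → 1+n≢0 (trans (sym (toℕ-fromℕ (suc k))) eq)))

recognises-attribute : ∀ n → Recognises (isAttributeᶠ n) (encodeAttribute {n})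
recognises-attribute zero    = (λ t h → contradiction refl h) , λ ()
recognises-attribute (suc n) = attribute⁻ , attribute⁺
  where
  attribute⁻ : ∀ t → Truthy (fun (isAttributeᶠ (suc n)) t) → ∃[ y ] encodeAttribute {suc n} y ≡ t
  attribute⁻ nil        h = 0F , refl
  attribute⁻ (cons (cons _ _) t) h = contradiction refl h
  attribute⁻ (cons nil t) h with proj₁ (recognises-attribute n) t h
  ... | y , refl = sucF y , refl
  attribute⁺ : ∀ y → Truthy (fun (isAttributeᶠ (suc n)) (encodeAttribute {suc n} y))
  attribute⁺ 0F       = λ ()
  attribute⁺ (sucF y) = proj₂ (recognises-attribute n) y

module _ (n : ℕ) where

  recognises-point : Recognises (isPointᶠ n) (encodeTimedAttribute {n})
  recognises-point = point⁻ , λ (y , i) →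
      ∧-intro (proj₂ (recognises-attribute n) y) (proj₂ recognises-integer i)
    where
    point⁻ : ∀ t → Truthy (fun (isPointᶠ n) t) → ∃[ p ] encodeTimedAttribute {n} p ≡ t
    point⁻ nil        h = contradiction refl h
    point⁻ (cons s t) h with ∧-elim (fun (isAttributeᶠ n) s) h
    ... | h₁ , h₂ with proj₁ (recognises-attribute n) s h₁ | proj₁ recognises-integer t h₂
    ... | y , refl | i , refl = (y , i) , refl

  recognises-set : Recognises (isSetᶠ n) (encodeList (encodeTimedAttribute {n}))
  recognises-set = (λ t → proj₁ (list t)) , λ A → proj₂ (list (encodeList encodeTimedAttribute A)) A refl
    where
    list : ∀ t → RecognisesList (isPointᶠ n) (encodeTimedAttribute {n}) idᶠ nilᶠ t
    list = recognises-list {p = isPointᶠ n} recognises-point idᶠ nilᶠ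

  recognises-formula : Recognises (isFormulaᶠ n) (encodeFormula {n})
  recognises-formula = formula⁻ , λ (A ⇒ B) →
      ∧-intro (proj₂ recognises-set A) (proj₂ recognises-set B)
    where
    formula⁻ : ∀ t → Truthy (fun (isFormulaᶠ n) t) → ∃[ φ ] encodeFormula {n} φ ≡ t
    formula⁻ nil        h = contradiction refl h
    formula⁻ (cons s t) h with ∧-elim (fun (isSetᶠ n) s) h
    ... | h₁ , h₂ with proj₁ recognises-set s h₁ | proj₁ recognises-set t h₂
    ... | A , refl | B , refl = A ⇒ B , refl

  recognises-instance : Recognises (isInstanceᶠ n) (encodeInstance {n})
  recognises-instance = instance⁻ , λ (T , φ) →
      proj₂ (list (encodeInstance (T , φ))) (φ ∷ T) refl
    where
    list : ∀ t → RecognisesList (isFormulaᶠ n) (encodeFormula {n}) formulasᶠ nilᶠ t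
    list = recognises-list {p = isFormulaᶠ n} recognises-formula formulasᶠ nilᶠ
    instance⁻ : ∀ t → Truthy (fun (isInstanceᶠ n) t) → ∃[ I ] encodeInstance {n} I ≡ t
    instance⁻ nil        h = contradiction refl h
    instance⁻ (cons s t) h with proj₁ (list (cons s t)) h
    ... | φ ∷ T , eq with cons-injective eq
    ...   | refl , refl = (T , φ) , refl

-- The longest numeral

numeral : Tree → Tree
numeral x = tail (tail x)

longer : Tree → Tree → Tree
longer acc xs = fun longerPoint (cons acc (cons xs nil))

longer-cases : ∀ acc h t → let r = longer acc (cons h t) in
  len acc ≤ len r × len (numeral h) ≤ len r × (r ≡ acc ⊎ r ≡ numeral h)
longer-cases acc h t with fun subᶠ (cons (numeral h) acc) | len-sub (numeral h) acc
... | nil      | eq = ≤-refl , m∸n≡0⇒m≤n (sym eq) , inj₁ refl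
... | cons _ _ | eq =
  <⇒≤ (m∸n≢0⇒n<m λ eq′ → 1+n≢0 (trans eq eq′)) , ≤-refl , inj₂ refl

longer-grows : ∀ {acc xs k} → k ≤ len acc → k ≤ len (longer acc xs)
longer-grows {acc} {xs} k≤ with fun subᶠ (cons (numeral (head xs)) acc) | len-sub (numeral (head xs)) acc
... | nil      | eq = k≤
... | cons _ _ | eq = ≤-trans k≤ (<⇒≤ (m∸n≢0⇒n<m λ eq′ → 1+n≢0 (trans eq eq′)))

module _ (Q : Tree → Set) where

  longer-invariant : ∀ l {acc} → (∀ {x} → x ∈ elements l → Q (numeral x)) → Q acc → Q (foldT longer l acc)
  longer-invariant l Ql = fold-invariant Q l step′
    where
    step′ : ∀ {h t acc} → cons h t ⊑ l → Q acc → Q (longer acc (cons h t))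
    step′ {h} {t} {acc} s Qacc with longer-cases acc h t
    ... | _ , _ , inj₁ eq = subst Q (sym eq) Qacc
    ... | _ , _ , inj₂ eq = subst Q (sym eq) (Ql (⊑⇒∈ s))

longer-fold-grows : ∀ l {acc k} → k ≤ len acc → k ≤ len (foldT longer l acc)
longer-fold-grows l {k = k} = fold-invariant (λ acc → k ≤ len acc) l
  (λ {h} {t} {acc} _ → longer-grows {acc} {cons h t})

longer-reaches : ∀ l {acc x} → x ∈ elements l → len (numeral x) ≤ len (foldT longer l acc)
longer-reaches l {acc} {x} x∈ with ∈⇒⊑ l x∈
... | t , s = fold-reaches {g = longer} (λ _ → Tree) (λ acc → len (numeral x) ≤ len acc)
  id (λ {acc} {xs} → longer-grows {acc} {xs}) s
  (λ {acc} _ → proj₁ (proj₂ (longer-cases acc x t))) {acc} nil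

longerF : Tree → Tree → Tree
longerF acc xs = fun longerFormula (cons acc (cons xs nil))

data _∈ᵖ_ (x : Tree) (ψ : Tree) : Set where
  antecedentᵖ : x ∈ elements (head ψ) → x ∈ᵖ ψ
  consequentᵖ : x ∈ elements (tail ψ) → x ∈ᵖ ψ

-- The result is `nil` or one of the numerals that occur, so a bound satisfied by each of them
-- carries over to it.
longest-invariant : (Q : Tree → Set) → Q nil → ∀ d →
  (∀ {ψ x} → ψ ∈ elements (fun formulasᶠ d) → x ∈ᵖ ψ → Q (numeral x)) → Q (fun longestᶠ d)
longest-invariant Q Qnil d Qd = fold-invariant {g = longerF} Q (fun formulasᶠ d)
  (λ {ψ} {t} {acc} s Qacc →
    longer-invariant Q (tail ψ) (Qd (⊑⇒∈ s) ∘ consequentᵖ)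
      (longer-invariant Q (head ψ) (Qd (⊑⇒∈ s) ∘ antecedentᵖ) Qacc)) Qnil

longest-reaches : ∀ d {ψ x} → ψ ∈ elements (fun formulasᶠ d) → x ∈ᵖ ψ →
  len (numeral x) ≤ len (fun longestᶠ d)
longest-reaches d {ψ} {x} ψ∈ x∈ with ∈⇒⊑ (fun formulasᶠ d) ψ∈
... | t , s = fold-reaches {g = longerF} (λ _ → Tree) (λ acc → len (numeral x) ≤ len acc)
  id (λ {acc} {xs} k≤ → longer-fold-grows (tail (head xs)) (longer-fold-grows (head (head xs)) {acc} k≤)) s
  (λ {acc} _ → hit acc x∈) {nil} nil
  where
  hit : ∀ acc → x ∈ᵖ ψ → len (numeral x) ≤ len (longerF acc (cons ψ t))
  hit acc (antecedentᵖ x∈) = longer-fold-grows (tail ψ) (longer-reaches (head ψ) {acc} x∈)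
  hit acc (consequentᵖ x∈) = longer-reaches (tail ψ) x∈

-- The least value with `l` bijective digits, all equal to 1, is `2 ^ l - 1`. This keeps the
-- computed powers linear in the magnitude.
2^len≤ : ∀ b → 2 ^ len (encodeℕᵇ b) ≤ suc (Bin.toℕ b)
2^len≤ 0ᵇ       = ≤-refl
2^len≤ 2[1+ b ] = m≤n⇒m≤1+n (*-monoʳ-≤ 2 (2^len≤ b))
2^len≤ 1+[2 b ] = ≤-trans (*-monoʳ-≤ 2 (2^len≤ b)) (≤-reflexive (*-suc 2 (Bin.toℕ b)))

-- The greatest value with `l` bijective digits, all equal to 2, is `2 ^ (l + 1) - 2`. This makes
-- `K = 2 ^ (l + 1)` large enough.
toℕ≤ : ∀ b → 2 + Bin.toℕ b ≤ 2 * 2 ^ len (encodeℕᵇ b)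
toℕ≤ 0ᵇ       = ≤-refl
toℕ≤ 2[1+ b ] = ≤-trans (≤-reflexive (sym (*-suc 2 (suc (Bin.toℕ b))))) (*-monoʳ-≤ 2 (toℕ≤ b))
toℕ≤ 1+[2 b ] = ≤-trans (≤-trans (n≤1+n _) (≤-reflexive (identity (Bin.toℕ b)))) (*-monoʳ-≤ 2 (toℕ≤ b))
  where
  identity : ∀ k → 4 + 2 * k ≡ 2 * (2 + k)
  identity k = sym (*-distribˡ-+ 2 2 k)

-- Powers of 2

powers : ℕ → Tree
powers zero    = cons (num 1) nil
powers (suc l) = cons (num (2 ^ suc l)) (powers l)

add-num : ∀ a b → fun addᶠ (cons (num a) (num b)) ≡ num (a + b)
add-num a zero    = cong num (sym (+-identityʳ a))
add-num a (suc b) = trans (add-num (suc a) b) (cong num (sym (+-suc a b)))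

head-powers : ∀ l → head (powers l) ≡ num (2 ^ l)
head-powers zero    = refl
head-powers (suc l) = refl

double-head : Tree → Tree
double-head W = fun addᶠ (cons (head W) (head W))

double-head-powers : ∀ l → double-head (powers l) ≡ num (2 ^ suc l)
double-head-powers l = begin
  fun addᶠ (cons (head (powers l)) (head (powers l)))
    ≡⟨ cong (λ w → fun addᶠ (cons w w)) (head-powers l) ⟩
  fun addᶠ (cons (num (2 ^ l)) (num (2 ^ l)))  ≡⟨ add-num (2 ^ l) (2 ^ l) ⟩
  num (2 ^ l + 2 ^ l)        ≡⟨ cong (λ k → num (2 ^ l + k)) (+-identityʳ (2 ^ l)) ⟨
  num (2 ^ suc l)            ∎
  where open ≡-Reasoning

powerStep : Fn
powerStep = consᶠ (addᶠ ∘ᶠ consᶠ (hdᶠ (hdᶠ idᶠ)) (hdᶠ (hdᶠ idᶠ))) (hdᶠ idᶠ)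

powerStep-powers : ∀ ρ xs l → stepT powerStep ρ (powers l) xs ≡ powers (suc l)
powerStep-powers ρ xs l = cong (λ w → cons w (powers l)) (double-head-powers l)

powers-fold : ∀ ρ xs l → foldT (stepT powerStep ρ) xs (powers l) ≡ powers (l + len xs)
powers-fold ρ nil        l = cong powers (sym (+-identityʳ l))
powers-fold ρ (cons h t) l = begin
  foldT (stepT powerStep ρ) t (stepT powerStep ρ (powers l) (cons h t))
    ≡⟨ cong (foldT (stepT powerStep ρ) t) (powerStep-powers ρ (cons h t) l) ⟩
  foldT (stepT powerStep ρ) t (powers (suc l))  ≡⟨ powers-fold ρ t (suc l) ⟩
  powers (suc l + len t)                        ≡⟨ cong powers (sym (+-suc l (len t))) ⟩
  powers (l + len (cons h t))                   ∎
  where open ≡-Reasoning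

size-num : ∀ k → size (num k) ≡ suc (2 * k)
size-num zero    = refl
size-num (suc k) = trans (cong (2 +_) (size-num k)) (cong suc (sym (*-suc 2 k)))

-- A geometric sum, dominated by its last term; the factor 8 leaves room for the cons cells of the
-- list.
size-powers : ∀ l → size (powers l) ≤ 8 * 2 ^ l
size-powers zero    = m≤m+n 5 3
size-powers (suc l) = begin
  suc (size (num (2 ^ suc l)) + size (powers l)) ≡⟨ cong (λ s → suc (s + size (powers l))) (size-num (2 ^ suc l)) ⟩
  2 + (2 * (2 * 2 ^ l) + size (powers l))
    ≤⟨ +-mono-≤ (*-monoʳ-≤ 2 (m^n>0 2 l)) (+-monoʳ-≤ (2 * (2 * 2 ^ l)) (size-powers l)) ⟩
  2 * 2 ^ l + (2 * (2 * 2 ^ l) + 8 * 2 ^ l)      ≡⟨ identity (2 ^ l) ⟩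
  14 * 2 ^ l                                     ≤⟨ *-monoˡ-≤ (2 ^ l) (m≤m+n 14 2) ⟩
  16 * 2 ^ l                                     ≡⟨ *-assoc 8 2 (2 ^ l) ⟩
  8 * 2 ^ suc l                                  ∎
  where
  open ≤-Reasoning
  identity : ∀ p → 2 * p + (2 * (2 * p) + 8 * p) ≡ 14 * p
  identity = ℕSolver.solve-∀

-- The accumulator holds the weights from the next higher power upwards, and each power collected
-- extends them downwards by one.
reverse-powers : ∀ l c → foldT (stepT (collectStep (hdᶠ idᶠ)) nil) (powers l) (weights c (2 ^ suc l)) ≡
  weights (suc l + c) 1
reverse-powers zero    c = refl
reverse-powers (suc l) c = trans (reverse-powers l (suc c)) (cong (λ k → weights (suc k) 1) (+-suc l c))

module _ {n : ℕ} (T : FiniteTheory n) (φ : Formula n) where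

  private
    d = encodeInstance (T , φ)

  abs≤magnitude : ∀ {ψ p} → ψ ∈ φ ∷ T → p ∈ antecedent ψ ++ consequent ψ →
    ∣ proj₂ p ∣ ≤ magnitudeInstance (T , φ)
  abs≤magnitude ψ∈ p∈ = All.lookup (xs≤max 0 (map ∣_∣ (concatMap timePoints (φ ∷ T))))
    (∈-map⁺ ∣_∣ (∈-concatMap⁺ timePoints (lose ψ∈ (∈-map⁺ proj₂ p∈))))

  longest-covers : ∀ {ψ p} → ψ ∈ φ ∷ T → p ∈ antecedent ψ ++ consequent ψ →
    len (encodeℕᵇ (fromℕ ∣ proj₂ p ∣)) ≤ len (fun longestᶠ d)
  longest-covers {ψ} ψ∈ p∈ = longest-reaches d
    (∈-encodeList⁺ encodeFormula ψ∈)
    ([ antecedentᵖ ∘ ∈-encodeList⁺ encodeTimedAttribute ,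
       consequentᵖ ∘ ∈-encodeList⁺ encodeTimedAttribute ]′ (∈-++⁻ (antecedent ψ) p∈))

  2^longest≤ : 2 ^ len (fun longestᶠ d) ≤ suc (magnitudeInstance (T , φ))
  2^longest≤ = longest-invariant (λ L → 2 ^ len L ≤ suc (magnitudeInstance (T , φ))) (s≤s z≤n) d numerals
    where
    bounded : ∀ {ψ p} → ψ ∈ φ ∷ T → p ∈ antecedent ψ ++ consequent ψ →
      2 ^ len (encodeℕᵇ (fromℕ ∣ proj₂ p ∣)) ≤ suc (magnitudeInstance (T , φ))
    bounded {p = _ , i} ψ∈ p∈ = ≤-trans (2^len≤ (fromℕ ∣ i ∣))
      (s≤s (≤-trans (≤-reflexive (toℕ-fromℕ ∣ i ∣)) (abs≤magnitude ψ∈ p∈)))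
    numerals : ∀ {ψ x} → ψ ∈ elements (fun formulasᶠ d) → x ∈ᵖ ψ →
      2 ^ len (numeral x) ≤ suc (magnitudeInstance (T , φ))
    numerals ψ∈ x∈ with ∈-encodeList⁻ encodeFormula (φ ∷ T) ψ∈
    numerals ψ∈ (antecedentᵖ x∈) | A ⇒ B , φ∈ , refl
      with ∈-encodeList⁻ encodeTimedAttribute A x∈
    ... | p , p∈ , refl = bounded φ∈ (∈-++⁺ˡ p∈)
    numerals ψ∈ (consequentᵖ x∈) | A ⇒ B , φ∈ , refl
      with ∈-encodeList⁻ encodeTimedAttribute B x∈
    ... | p , p∈ , refl = bounded φ∈ (∈-++⁺ʳ A p∈)

abs-≤ : ∀ {i k} → ∣ i ∣ ≤ k → i ℤ.≤ pos k
abs-≤ {pos _}    a≤k = +≤+ a≤k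
abs-≤ { -[1+ _ ]} a≤k = -≤+

abs-≥ : ∀ {i k} → ∣ i ∣ ≤ k → ℤ.- pos k ℤ.≤ i
abs-≥ {i} {k} a≤k = subst (ℤ.- pos k ℤ.≤_) (ℤ.neg-involutive i)
  (ℤ.neg-mono-≤ (abs-≤ (≤-trans (≤-reflexive (ℤ.∣-i∣≡∣i∣ i)) a≤k)))

-- Correctness of the main part

assemble : Tree → Tree → Tree → Tree
assemble V K d = cons
  (cons (fun shiftSetᶠ (cons (head φ) 2K)) (fun shiftSetᶠ (cons (tail φ) 2K)))
  (cons (fun (collectᶠ convFormulaᶠ (hdᶠ idᶠ) nilᶠ (tlᶠ idᶠ)) (cons (head d) (cons V K)))
        (cons nil (fun addᶠ (cons 2K 2K))))
  where
  φ  = fun convFormulaᶠ (cons (tail d) (cons V K))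
  2K = fun addᶠ (cons K K)

main-assemble : ∀ n d l → fun (mainᶠ n) (cons d (powers l)) ≡
  fun (answerᶠ n) (assemble (weights (suc l) 1) (double-head (powers l)) d)
main-assemble n d l = cong (λ V → fun (answerᶠ n) (assemble V (double-head (powers l)) d))
  (trans (reverse-powers l 0) (cong (λ k → weights (suc k) 1) (+-identityʳ l)))

module _ {n : ℕ} (T : FiniteTheory n) (A B : FiniteSubset n) where

  private
    d = encodeInstance (T , A ⇒ B)
    l = len (fun longestᶠ d)
    K = double-head (powers l)
    k = len K
    2K J assembled : Tree
    2K = fun addᶠ (cons K K)
    J = cons nil (fun addᶠ (cons 2K 2K))
    assembled = assemble (weights (suc l) 1) K d

    len-K : k ≡ 2 ^ suc l
    len-K = trans (cong len (double-head-powers l)) (len-num (2 ^ suc l))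

    in-range : ∀ {ψ p} → ψ ∈ (A ⇒ B) ∷ T → p ∈ antecedent ψ ++ consequent ψ → InRange (suc l) K p
    in-range {p = _ , i} ψ∈ p∈ = (begin
        ∣ i ∣                                       ≡⟨ toℕ-fromℕ ∣ i ∣ ⟨
        Bin.toℕ (fromℕ ∣ i ∣)                       ≤⟨ m≤n+m _ 2 ⟩
        2 + Bin.toℕ (fromℕ ∣ i ∣)                   ≤⟨ toℕ≤ (fromℕ ∣ i ∣) ⟩
        2 * 2 ^ len (encodeℕᵇ (fromℕ ∣ i ∣))
          ≤⟨ *-monoʳ-≤ 2 (^-monoʳ-≤ 2 (longest-covers T (A ⇒ B) ψ∈ p∈)) ⟩
        2 ^ suc l                                   ≡⟨ len-K ⟨
        k                                           ∎) ,
      m≤n⇒m≤1+n (longest-covers T (A ⇒ B) ψ∈ p∈)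
      where open ≤-Reasoning

    formula-in-range : ∀ {ψ} → ψ ∈ (A ⇒ B) ∷ T → FormulaInRange (suc l) K ψ
    formula-in-range {C ⇒ D} ψ∈ = in-range ψ∈ ∘ ∈-++⁺ˡ , in-range ψ∈ ∘ ∈-++⁺ʳ C

    represented : RepresentsFormula k (A ⇒ B)
      (fun convFormulaᶠ (cons (tail d) (cons (weights (suc l) 1) K)))
    represented = represents-convFormula (suc l) K (A ⇒ B) (formula-in-range (here refl))

    shifted : ∀ {C : FiniteSubset n} {M} → Represents k C M →
      Represents (k + (k + k)) C (fun shiftSetᶠ (cons M 2K))
    shifted {C} {M} rep = subst (λ m → Represents (k + m) C (fun shiftSetᶠ (cons M 2K)))
      (len-add K K) (represents-shift 2K rep)

    len-J : len J ≡ suc (k + (k + (k + k)))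
    len-J = cong suc (begin
      len (fun addᶠ (cons 2K 2K))  ≡⟨ len-add 2K 2K ⟩
      len 2K + len 2K              ≡⟨ cong₂ _+_ (len-add K K) (len-add K K) ⟩
      k + k + (k + k)              ≡⟨ +-assoc k k (k + k) ⟩
      k + (k + (k + k))            ∎)
      where open ≡-Reasoning

    module Answer = Correctness {T = T} {A} {B} {k} {head (tail assembled)} {head assembled} {J}
      (represents-convTheory (suc l) K T (λ ψ∈ → formula-in-range (there ψ∈)))
      (shifted (proj₁ represented) , shifted (proj₂ represented))
      len-J
      (λ ψ∈ p∈ → abs-≤ (proj₁ (proj₁ (formula-in-range (there ψ∈)) p∈)))
      (λ p∈ → abs-≥ (proj₁ (proj₁ (formula-in-range (here refl)) p∈)))
      (λ p∈ → abs-≤ (proj₁ (proj₂ (formula-in-range (here refl)) p∈)))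

  main⁻ : Truthy (fun (mainᶠ n) (cons d (powers l))) →
    Predictive (A ⇒ B) × All Predictive T × (∀ {p} → p ∈ B → Closure T A p)
  main⁻ h = Answer.answer⁻ (subst Truthy (main-assemble n d l) h)

  main⁺ : Predictive (A ⇒ B) → All Predictive T → (∀ {p} → p ∈ B → Closure T A p) →
    Truthy (fun (mainᶠ n) (cons d (powers l)))
  main⁺ predφ predT h = subst Truthy (sym (main-assemble n d l)) (Answer.answer⁺ predφ predT h)

-- The decision procedure

module _ (n : ℕ) where

  check prepare finish : Fn
  check   = consᶠ (isInstanceᶠ n) idᶠ
  -- The initial loop state: each digit of the longest numeral triggers one doubling, and the list
  -- of powers begins with 1 alone, since `trueᶠ` is also the unary 1.
  prepare = consᶠ longestᶠ (consᶠ (consᶠ trueᶠ nilᶠ) idᶠ)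
  finish  = mainᶠ n ∘ᶠ consᶠ (tlᶠ (tlᶠ idᶠ)) (hdᶠ (tlᶠ idᶠ))

  -- The loop computing the powers is the only part whose running time is
  -- not polynomial in the size of its input.
  decide : Command 2
  decide = code check ⨾
    cond (hd (var X))
      (X := tl (var X) ⨾ code prepare ⨾ loopCode (code (advance powerStep)) ⨾ code finish)
      (X := nil)

  loopStates runningTime : Bound
  loopStates  = con 1 ⊞ (space longestᶠ ⊞ (con 1 ⊞ (con 8 ⊠ (con 1 ⊞ arg) ⊞ arg)))
  runningTime = time check ⊞ (con 6 ⊞ (time prepare ⊞
    (space longestᶠ ⊠ (con 3 ⊞ time (advance powerStep) ⊚ loopStates) ⊞
     time finish ⊚ loopStates)))

  module _ (d : Tree) (m : ℕ) (2^l≤ : 2 ^ len (fun longestᶠ d) ≤ suc m) where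

    private
      L = fun longestᶠ d
      N = size d + m

    -- Doubling is not additive in the accumulator, so the size is controlled by the exponent
    -- instead: the number of doublings done and the digits left add up to the length of the longest
    -- numeral, and `2^l≤` bounds the corresponding power.
    PowerInv : Tree → Tree → Set
    PowerInv xs acc = ∃[ i ] (acc ≡ powers i × i + len xs ≡ len L × size xs ≤ size L)

    powerInv-step : ∀ h t acc → PowerInv (cons h t) acc → PowerInv t (stepT powerStep d acc (cons h t))
    powerInv-step h t _ (i , refl , i+≡ , xs≤) =
      suc i , powerStep-powers d (cons h t) i , trans (sym (+-suc i (len t))) i+≡ , size-tail-≤ h t xs≤

    powerInv-size : ∀ xs acc → PowerInv xs acc → size (cons xs (cons acc d)) ≤ ⟪ loopStates ⟫ N
    powerInv-size xs _ (i , refl , i+≡ , xs≤) = +-mono-≤ (≤-refl {1}) (+-mono-≤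
      (≤-trans xs≤ (≤-trans (size-fun longestᶠ d) (⟪⟫-mono (space longestᶠ) (m≤m+n (size d) m))))
      (+-mono-≤ (≤-refl {1}) (+-mono-≤ powers≤ (m≤m+n (size d) m))))
      where
      open ≤-Reasoning
      powers≤ : size (powers i) ≤ 8 * (1 + N)
      powers≤ = begin
        size (powers i)  ≤⟨ size-powers i ⟩
        8 * 2 ^ i        ≤⟨ *-monoʳ-≤ 8 (^-monoʳ-≤ 2 (≤-trans (m≤m+n i (len xs)) (≤-reflexive i+≡))) ⟩
        8 * 2 ^ len L    ≤⟨ *-monoʳ-≤ 8 2^l≤ ⟩
        8 * suc m        ≤⟨ *-monoʳ-≤ 8 (s≤s (m≤n+m m (size d))) ⟩
        8 * suc N        ∎

    runs-valid : Truthy (fun (isInstanceᶠ n) d) → ∃[ t ]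
      ⟨ decide , d ∷ nil ∷ [] ⟩⇓ fun (mainᶠ n) (cons d (powers (len L))) ∷ nil ∷ [] in-time t ×
      t ≤ ⟪ runningTime ⟫ N
    runs-valid valid = let
        r , run₁ , r≤ = computes check d nil
        s , run₂ , s≤ = computes prepare d nil
        t , run₃ , t≤ = loop-computes (advance powerStep) (stepT powerStep d) d (λ h t acc → refl)
          (⟪ loopStates ⟫ N) PowerInv powerInv-step powerInv-size
          L (powers 0) (0 , refl , refl , ≤-refl) nil
        u , run₄ , u≤ = computes finish (cons nil (cons (powers (len L)) d)) nil
        run₃′ = subst (λ W → ⟨ loopCode (code (advance powerStep)) , fun prepare d ∷ nil ∷ [] ⟩⇓
                  cons nil (cons W d) ∷ nil ∷ [] in-time t) (powers-fold d L 0) run₃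
      in _ , seq run₁ (cond-true valid (seq assign (seq run₂ (seq run₃′ run₄)))) ,
         +-mono-≤ (≤-trans r≤ (⟪⟫-mono (time check) d≤N)) (+-monoʳ-≤ 6
           (+-mono-≤ (≤-trans s≤ (⟪⟫-mono (time prepare) d≤N))
             (+-mono-≤ (≤-trans t≤ (*-monoˡ-≤ (3 + ⟪ time (advance powerStep) ⟫ (⟪ loopStates ⟫ N))
                 (≤-trans (size-fun longestᶠ d) (⟪⟫-mono (space longestᶠ) d≤N))))
               (≤-trans u≤ (⟪⟫-mono (time finish)
                 (powerInv-size nil (powers (len L)) (len L , refl , +-identityʳ (len L) , 1≤size L)))))))
      where
      d≤N : size d ≤ N
      d≤N = m≤m+n (size d) m

  runs-invalid : ∀ d m → fun (isInstanceᶠ n) d ≡ nil → ∃[ t ]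
    ⟨ decide , d ∷ nil ∷ [] ⟩⇓ nil ∷ nil ∷ [] in-time t × t ≤ ⟪ runningTime ⟫ (size d + m)
  runs-invalid d m invalid = let
      r , run₁ , r≤ = computes check d nil
    in _ , seq run₁ (cond-false invalid assign) ,
       +-mono-≤ (≤-trans r≤ (⟪⟫-mono (time check) (m≤m+n (size d) m))) (≤-trans (n≤1+n 5) (m≤m+n 6 _))

  Decides : Tree → Tree → Set
  Decides d output = (Truthy output × (L-ENT n ∩ L-PRE n) d) ⊎ (output ≡ nil × ¬ (L-ENT n ∩ L-PRE n) d)

  main-decides : ∀ I → let d = encodeInstance I in
    Decides d (fun (mainᶠ n) (cons d (powers (len (fun longestᶠ d)))))
  main-decides I@(T , A ⇒ B) = [ (λ rejected → inj₂ (rejected , λ d∈L → refute rejected d∈L)) , accept ]′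
    (nil-or-truthy output)
    where
    output : Tree
    output = fun (mainᶠ n) (cons (encodeInstance I) (powers (len (fun longestᶠ (encodeInstance I)))))
    accept : Truthy output → Decides (encodeInstance I) output
    accept accepted = let predφ , predT , derivable = main⁻ T A B accepted in
      inj₁ (accepted , (I , refl , ⊢-complete derivable) , (I , refl , predT , predφ))
    refute : output ≡ nil → ¬ (L-ENT n ∩ L-PRE n) (encodeInstance I)
    refute rejected ((I₁ , eq₁ , I₁⊢) , (I₂ , eq₂ , predT , predφ)) =
      reject (encodeInstance-injective I₁ I eq₁) I₁⊢ (encodeInstance-injective I₂ I eq₂) predT predφ
      where
      reject : ∀ {I₁ I₂ : Instance n} → I₁ ≡ I → proj₁ I₁ ⊢ proj₂ I₁ → I₂ ≡ I →
        All Predictive (proj₁ I₂) → ¬ Predictive (proj₂ I₂)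
      reject refl I⊢ refl predT predφ = main⁺ T A B predφ predT (⊢-sound I⊢) rejected

  timeBound : Polynomial 2
  timeBound = substitute runningTime (+-*-Solver.var 0F :+ +-*-Solver.var (sucF 0F))

  ≤timeBound : ∀ s m {t} → t ≤ ⟪ runningTime ⟫ (s + m) → t ≤ ⟦ timeBound ⟧ (s ∷ m ∷ [])
  ≤timeBound s m t≤ = ≤-trans t≤ (≤-reflexive
    (sym (⟦substitute⟧ runningTime (+-*-Solver.var 0F :+ +-*-Solver.var (sucF 0F)) (s ∷ m ∷ []))))

  Decided : Tree → Set
  Decided d = ∃[ output ] ∃[ t ]
    RunsTo (1 , decide) d output t ×
    (∀ m → (∀ I → encodeInstance {n} I ≡ d → magnitudeInstance I ≤ m) →
       t ≤ ⟦ timeBound ⟧ (size d ∷ m ∷ [])) ×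
    Decides d output

  -- Here every `m` is admissible, even 0, so the time has to be bounded by the size of `d` alone;
  -- it is, since only the recogniser runs.
  decided-invalid : ∀ d → fun (isInstanceᶠ n) d ≡ nil → Decided d
  decided-invalid d invalid = let t , run , t≤ = runs-invalid d 0 invalid in
    nil , t , (nil ∷ [] , run) ,
    (λ m _ → ≤timeBound (size d) m (≤-trans t≤ (⟪⟫-mono runningTime (+-monoʳ-≤ (size d) z≤n)))) ,
    inj₂ (refl , λ ((I , eq , _) , _) →
      subst Truthy (trans (cong (fun (isInstanceᶠ n)) eq) invalid) (proj₂ (recognises-instance n) I) refl)

  decided-instance : ∀ I → Decided (encodeInstance I)
  decided-instance I@(T , φ) = let
      d = encodeInstance I
      t , run , t≤ = runs-valid d (magnitudeInstance I) (2^longest≤ T φ) (proj₂ (recognises-instance n) I)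
    in _ , t , (nil ∷ [] , run) ,
       (λ m I≤ → ≤timeBound (size d) m
         (≤-trans t≤ (⟪⟫-mono runningTime (+-monoʳ-≤ (size d) (I≤ I refl))))) ,
       main-decides I

theorem15 : (n : ℕ) → .{{_ : NonZero n}} →
    DecidableInPseudoPolynomialTime (encodeInstance {n}) magnitudeInstance (L-ENT n ∩ L-PRE n)
theorem15 n = (1 , decide n) , timeBound n , λ d →
  [ decided-invalid n d , (λ valid → let I , eq = proj₁ (recognises-instance n) d valid in
      subst (Decided n) eq (decided-instance n I)) ]′ (nil-or-truthy (fun (isInstanceᶠ n) d))
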